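{- For fixed $k\in\{1,\dots,n-1\}$, the number of distributive (equivalently, modular) intervals $[\sigma_k,w]_{\mathrm{wk}}$ (with $w\in\mathfrak{S}_n$, $\sigma_k\le_{\mathrm{wk}}w$) in the weak order on $\mathfrak{S}_n$ is $C_n-C_{n-1}$, where $C_i$ is the $i$th Catalan number.
   Context: $\mathfrak{S}_n$ is the symmetric group with Coxeter generators $\sigma_1,\dots,\sigma_{n-1}$, where $\sigma_i$ is the transposition swapping $i$ and $i+1$. A reduced decomposition of $w$ is a word of minimal length in these generators with product $w$. (Right) weak order: $v\le_{\mathrm{wk}}w$ if some reduced decomposition of $v$ is a prefix of a reduced decomposition of $w$. $[v,w]_{\mathrm{wk}}=\{u: v\le_{\mathrm{wk}}u\le_{\mathrm{wk}}w\}$ for $v\le_{\mathrm{wk}}w$. An interval is called distributive (modular) if it is a distributive (modular) lattice. Catalan numbers: $C_i=\frac{1}{i+1}\binom{2i}{i}$. -}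

module Defs where

open import Data.Fin.Base using (Fin; suc; inject₁)
open import Data.Fin.Permutation using (Permutation′; _≈_; id; _∘ₚ_; transpose)
open import Data.List.Base using (List; []; _∷_; length)
open import Data.List.Relation.Binary.Prefix.Heterogeneous using (Prefix)
open import Data.Nat.Base as ℕ using (ℕ; suc; _*_; _/_)
open import Data.Nat.Combinatorics using (_C_)
open import Data.Product.Base using (Σ; ∃₂; _×_; proj₁)
open import Function.Base using (_on_)
open import Function.Bundles using (Inverse)
open import Level using (0ℓ)
open import Relation.Binary.Bundles using (Setoid)
open import Relation.Binary.Core using (Rel)
import Relation.Binary.Construct.On as On
open import Relation.Binary.Lattice.Structures using (IsLattice; IsDistributiveLattice)
open import Relation.Binary.PropositionalEquality.Core using (_≡_; refl; sym; trans)
open import Relation.Binary.PropositionalEquality.Properties using (setoid)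
open import Relation.Unary using (Pred)

catalan : ℕ → ℕ
catalan i = ((2 * i) C i) / suc i

permutationSetoid : ℕ → Setoid 0ℓ 0ℓ
permutationSetoid n = record
  { Carrier       = Permutation′ n
  ; _≈_           = _≈_
  ; isEquivalence = record
    { refl  = λ _ → refl
    ; sym   = λ p i → sym (p i)
    ; trans = λ p q i → trans (p i) (q i)
    }
  }

-- The symmetric group on n + 1 letters is `Permutation′ (suc n)`; its
-- n Coxeter generators are indexed by `Fin n`, counting from 0, so that
-- `σ i` swaps the (0-based) letters i and i + 1.
σ : ∀ {n} → Fin n → Permutation′ (suc n)
σ i = transpose (inject₁ i) (suc i)

-- `π ∘ₚ ρ` applies π first.  Products of words are taken in the usual
-- functional convention (rightmost factor applied first), so the head of
-- the word is the factor applied last.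
product : ∀ {n} → List (Fin n) → Permutation′ (suc n)
product []       = id
product (i ∷ is) = product is ∘ₚ σ i

record ReducedDecomposition {n} (s : List (Fin n)) (w : Permutation′ (suc n)) : Set where
  field
    product≈ : product s ≈ w
    minimal  : ∀ t → product t ≈ w → length s ℕ.≤ length t

infix 4 _≤wk_

_≤wk_ : ∀ {n} → Rel (Permutation′ (suc n)) 0ℓ
v ≤wk w = ∃₂ λ s t →
  ReducedDecomposition s v × ReducedDecomposition t w × Prefix _≡_ s t

Interval : ∀ {n} → Permutation′ (suc n) → Permutation′ (suc n) → Set
Interval v w = Σ (Permutation′ _) λ u → v ≤wk u × u ≤wk w

record IsModularLattice {A : Set} (_≈′_ _≤′_ : Rel A 0ℓ) (_∨_ _∧_ : A → A → A) : Set where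
  field
    isLattice : IsLattice _≈′_ _≤′_ _∨_ _∧_
    modular   : ∀ x y z → x ≤′ z → (x ∨ (y ∧ z)) ≈′ ((x ∨ y) ∧ z)

-- Elements of an interval are compared through their underlying
-- permutations: the proofs of membership are irrelevant.
DistributiveInterval : ∀ {n} → Rel (Permutation′ (suc n)) 0ℓ
DistributiveInterval v w = ∃₂ λ (_∨_ _∧_ : Interval v w → Interval v w → Interval v w) →
  IsDistributiveLattice (_≈_ on proj₁) (_≤wk_ on proj₁) _∨_ _∧_

ModularInterval : ∀ {n} → Rel (Permutation′ (suc n)) 0ℓ
ModularInterval v w = ∃₂ λ (_∨_ _∧_ : Interval v w → Interval v w → Interval v w) →
  IsModularLattice (_≈_ on proj₁) (_≤wk_ on proj₁) _∨_ _∧_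

-- `Count P m`: exactly m permutations, up to pointwise equality, satisfy P.
Count : ∀ {n} → Pred (Permutation′ n) 0ℓ → ℕ → Set
Count {n} P m =
  Inverse (setoid (Fin m)) (On.setoid {B = Σ (Permutation′ n) P} (permutationSetoid n) proj₁)

{-# OPTIONS --safe #-}
module Submission where

-- A permutation is determined by its set of inverted pairs of values, and v ≤wk w iff every
-- inversion of v is one of w.  If every 321-pattern of w involves both letters exchanged by σ k,
-- then unions and intersections of the inversion sets in [σ k , w] are again inversion sets, so
-- the interval is a sublattice of a power set.  Any other 321-pattern can be made consecutive by
-- descending in the interval, which then contains a hexagon and is not modular.
--
-- The condition on w says that u = σ k w avoids 321 and has its letters k and k + 1 in increasing
-- order.  Removing the smallest letter repeatedly encodes a permutation by insertion positions;
-- 321 is avoided iff each insertion happens within the initial increasing run of what is already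
-- there.  Counting with a weight depending on the length of that run shows that the
-- 321-avoiding permutations of n + 1 letters with k and k + 1 in decreasing order are as many as
-- all those of n letters.  The total numbers are ballot numbers, hence Catalan numbers.

open import Defs
import Data.Fin.Base as Fin
open import Data.Bool.Base using (if_then_else_)
open import Data.Fin.Base using (Fin; zero; suc; inject₁; toℕ; _<_; punchIn; punchOut; fromℕ<)
open import Data.Fin.Permutation
  using (Permutation′; _≈_; id; _∘ₚ_; _⟨$⟩ˡ_; _⟨$⟩ʳ_; inverseˡ; inverseʳ
        ; permutation; insert; remove)
open import Data.Fin.Properties as Fin using (toℕ-inject₁; toℕ-injective; <-cmp)
open import Data.List.Base as List
  using (List; []; _∷_; length; _++_; filter; lookup; allFin; cartesianProductWith)
open import Data.List.Membership.Propositional using () renaming (_∈_ to _∈ˡ_)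
open import Data.List.Membership.Propositional.Properties
  using (∈-lookup; ∈-filter⁺; ∈-filter⁻; ∈-allFin; ∈-cartesianProductWith⁺)
open import Data.List.Properties using (length-++; map-++; map-∘; map-tabulate)
open import Data.List.Relation.Binary.Prefix.Heterogeneous using (Prefix; []; _∷_)
import Data.List.Relation.Unary.All as All
open import Data.List.Relation.Unary.AllPairs using ([]; _∷_)
open import Data.List.Relation.Unary.Any using (here; index)
open import Data.List.Relation.Unary.Any.Properties using (lookup-index)
open import Data.List.Relation.Unary.Unique.Propositional using (Unique)
import Data.List.Relation.Unary.Unique.Propositional.Properties as Unique
open import Data.Nat.Base as ℕ using (ℕ; zero; suc; _+_; _*_; _∸_; _/_; z≤n; s≤s)
open import Data.Nat.Combinatorics using (_C_; nCk+nC[k+1]≡[n+1]C[k+1]; nC1≡n; nCk≡nC[n∸k])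
open import Data.Nat.Combinatorics.Specification using (k>n⇒nCk≡0)
open import Data.Nat.DivMod using (m*n/n≡m)
open import Data.Nat.ListAction using () renaming (sum to listSum)
open import Data.Nat.ListAction.Properties using (sum-++)
import Data.Nat.Properties as ℕ
open import Data.Nat.Tactic.RingSolver using (solve-∀)
open import Data.Product.Base using (Σ; ∃; _×_; _,_; proj₁; proj₂; map₂)
open import Data.Sum.Base using (_⊎_; inj₁; inj₂; [_,_]′)
open import Data.Unit.Base using (⊤; tt)
open import Function.Base using (_∘_)
open import Function.Bundles using (_⇔_; mk⇔)
open import Function.Definitions using (Injective)
open import Relation.Binary.Bundles using (Setoid)
import Relation.Binary.Construct.On as On
open import Relation.Binary.Definitions using (tri<; tri≈; tri>)
open import Relation.Binary.Lattice.Structures using (IsLattice; IsDistributiveLattice)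
open import Relation.Binary.PropositionalEquality
open import Relation.Binary.Structures using (IsPartialOrder)
open import Relation.Nullary using (¬_; Dec; yes; no; does; contradiction)
open import Relation.Nullary.Decidable
  using (_×-dec_; _⊎-dec_; ¬?; map′; decidable-stable; dec-true; dec-false)
open import Algebra.Properties.CommutativeMonoid.Sum ℕ.+-0-commutativeMonoid
  using (sum; sum-cong-≗; ∑-distrib-+)
open import Algebra.Properties.Semiring.Sum ℕ.+-*-semiring using (*-distribˡ-sum)

private
  variable
    n : ℕ
    P Q : Set
    A B D : Set

-- Finite sums and indicators

sum-mono-≤ : ∀ {n} {f g : Fin n → ℕ} → (∀ i → f i ℕ.≤ g i) → sum f ℕ.≤ sum g
sum-mono-≤ {zero}  f≤g = z≤n
sum-mono-≤ {suc n} f≤g = ℕ.+-mono-≤ (f≤g zero) (sum-mono-≤ (f≤g ∘ suc))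

sum-suc : ∀ {n} {f g : Fin n → ℕ} i → (∀ j → j ≢ i → g j ≡ f j) →
          g i ≡ suc (f i) → sum g ≡ suc (sum f)
sum-suc {suc n} {f} {g} zero g≡f gi = cong₂ _+_ gi (sum-cong-≗ {n} λ j → g≡f (suc j) λ ())
sum-suc {suc n} {f} {g} (suc i) g≡f gi = trans
  (cong₂ _+_ (g≡f zero λ ()) (sum-suc i (λ j j≢i → g≡f (suc j) (j≢i ∘ Fin.suc-injective)) gi))
  (ℕ.+-suc (f zero) _)

sum-zero : ∀ {n} {f : Fin n → ℕ} → (∀ i → f i ≡ 0) → sum f ≡ 0
sum-zero {zero}  eq = refl
sum-zero {suc n} eq = cong₂ _+_ (eq zero) (sum-zero (eq ∘ suc))

indicator : Dec P → ℕ
indicator P? = if does P? then 1 else 0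

indicator-mono : (P? : Dec P) (Q? : Dec Q) → (P → Q) → indicator P? ℕ.≤ indicator Q?
indicator-mono (no _)  _       _   = z≤n
indicator-mono (yes p) (yes _) _   = ℕ.≤-refl
indicator-mono (yes p) (no ¬q) p⇒q = contradiction (p⇒q p) ¬q

indicator-yes : (P? : Dec P) → P → indicator P? ≡ 1
indicator-yes (yes _) _ = refl
indicator-yes (no ¬p) p = contradiction p ¬p

indicator-no : (P? : Dec P) → ¬ P → indicator P? ≡ 0
indicator-no (no _)  _  = refl
indicator-no (yes p) ¬p = contradiction p ¬p

indicator-cong : (P? : Dec P) (Q? : Dec Q) → (P → Q) → (Q → P) → indicator P? ≡ indicator Q?
indicator-cong P? Q? p⇒q q⇒p =
  ℕ.≤-antisym (indicator-mono P? Q? p⇒q) (indicator-mono Q? P? q⇒p)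

-- Adjacent transpositions

-- The inverse direction of `σ i` is taken so that, by computation, `pos (σ i ∘ₚ w) a` is
-- `τ i (pos w a)` and `pos (w ∘ₚ σ i) a` is `pos w (τ i a)`.
τ : Fin n → Fin (suc n) → Fin (suc n)
τ i = σ i ⟨$⟩ˡ_

data τ-View (i : Fin n) (x : Fin (suc n)) : Set where
  low   : x ≡ inject₁ i → τ i x ≡ suc i → τ-View i x
  high  : x ≡ suc i → τ i x ≡ inject₁ i → τ-View i x
  other : x ≢ inject₁ i → x ≢ suc i → τ i x ≡ x → τ-View i x

inject₁<suc : (i : Fin n) → inject₁ i < suc i
inject₁<suc i = s≤s (ℕ.≤-reflexive (toℕ-inject₁ i))

inject₁≢suc : (i : Fin n) → inject₁ i ≢ suc i
inject₁≢suc i eq = ℕ.<-irrefl (cong toℕ eq) (inject₁<suc i)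

τ-view : (i : Fin n) (x : Fin (suc n)) → τ-View i x
τ-view i x with x Fin.≟ suc i | x Fin.≟ inject₁ i
... | yes refl | _        = high refl eq
  where
  eq : τ i (suc i) ≡ inject₁ i
  eq rewrite dec-true (i Fin.≟ i) refl = refl
... | no x≢1+i | yes refl = low refl eq
  where
  eq : τ i (inject₁ i) ≡ suc i
  eq rewrite dec-false (inject₁ i Fin.≟ suc i) x≢1+i
           | dec-true (inject₁ i Fin.≟ inject₁ i) refl = refl
... | no x≢1+i | no x≢i   = other x≢i x≢1+i eq
  where
  eq : τ i x ≡ x
  eq rewrite dec-false (x Fin.≟ suc i) x≢1+i
           | dec-false (x Fin.≟ inject₁ i) x≢i = refl

τ-inject₁ : (i : Fin n) → τ i (inject₁ i) ≡ suc i
τ-inject₁ i with τ-view i (inject₁ i)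
... | low _ eq    = eq
... | high eq _   = contradiction eq (inject₁≢suc i)
... | other neq _ _ = contradiction refl neq

τ-suc : (i : Fin n) → τ i (suc i) ≡ inject₁ i
τ-suc i with τ-view i (suc i)
... | low eq _      = contradiction (sym eq) (inject₁≢suc i)
... | high _ eq     = eq
... | other _ neq _ = contradiction refl neq

τ-involutive : (i : Fin n) (x : Fin (suc n)) → τ i (τ i x) ≡ x
τ-involutive i x with τ-view i x
... | low refl eq   = trans (cong (τ i) eq) (τ-suc i)
... | high refl eq  = trans (cong (τ i) eq) (τ-inject₁ i)
... | other _ _ eq  = trans (cong (τ i) eq) eq

σ≡τ : (i : Fin n) (x : Fin (suc n)) → σ i ⟨$⟩ʳ x ≡ τ i x
σ≡τ i x = trans (cong (σ i ⟨$⟩ʳ_) (sym (τ-involutive i x))) (inverseʳ (σ i))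

between : {i : Fin n} {x : Fin (suc n)} → inject₁ i < x → x < suc i → P
between {i = i} i<x x<1+i =
  contradiction (ℕ.≤-trans (s≤s (ℕ.≤-reflexive (sym (toℕ-inject₁ i)))) i<x)
                (ℕ.<⇒≱ x<1+i)

<suc⇒<inject₁ : {i : Fin n} {x : Fin (suc n)} → x ≢ inject₁ i → x < suc i → x < inject₁ i
<suc⇒<inject₁ {i = i} {x} x≢ x<1+i with <-cmp x (inject₁ i)
... | tri< x<i _ _ = x<i
... | tri≈ _ x≡i _ = contradiction x≡i x≢
... | tri> _ _ i<x = between i<x x<1+i

inject₁<⇒suc< : {i : Fin n} {x : Fin (suc n)} → x ≢ suc i → inject₁ i < x → suc i < x
inject₁<⇒suc< {i = i} {x} x≢ i<x with <-cmp x (suc i)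
... | tri< x<1+i _ _ = between i<x x<1+i
... | tri≈ _ x≡1+i _ = contradiction x≡1+i x≢
... | tri> _ _ 1+i<x = 1+i<x

-- No index lies strictly between the two exchanged ones, so moving one of them by one step never
-- passes a third.
τ-mono-< : (i : Fin n) {x y : Fin (suc n)} → x < y →
           ¬ (x ≡ inject₁ i × y ≡ suc i) → τ i x < τ i y
τ-mono-< i {x} {y} x<y ¬swapped with τ-view i x | τ-view i y
... | low refl eqx | low refl eqy = contradiction x<y (ℕ.<-irrefl refl)
... | low refl eqx | high refl eqy = contradiction (refl , refl) ¬swapped
... | low refl eqx | other _ y≢ eqy rewrite eqx | eqy = inject₁<⇒suc< y≢ x<y
... | high refl eqx | low refl eqy = contradiction x<y (ℕ.<-asym (inject₁<suc i))
... | high refl eqx | high refl eqy = contradiction x<y (ℕ.<-irrefl refl)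
... | high refl eqx | other _ _ eqy rewrite eqx | eqy = ℕ.<-trans (inject₁<suc i) x<y
... | other _ _ eqx | low refl eqy rewrite eqx | eqy = ℕ.<-trans x<y (inject₁<suc i)
... | other x≢ _ eqx | high refl eqy rewrite eqx | eqy = <suc⇒<inject₁ x≢ x<y
... | other _ _ eqx | other _ _ eqy rewrite eqx | eqy = x<y

-- Inversions

pos : Permutation′ n → Fin n → Fin n
pos w = w ⟨$⟩ˡ_

pos-injective : (w : Permutation′ n) {a b : Fin n} → pos w a ≡ pos w b → a ≡ b
pos-injective w eq = trans (sym (inverseʳ w)) (trans (cong (w ⟨$⟩ʳ_) eq) (inverseʳ w))

pos-cong : (v w : Permutation′ n) → v ≈ w → ∀ a → pos v a ≡ pos w a
pos-cong v w v≈w a =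
  trans (sym (inverseˡ w)) (cong (pos w) (trans (sym (v≈w _)) (inverseʳ v)))

pos-cong⁻¹ : (v w : Permutation′ n) → (∀ a → pos v a ≡ pos w a) → v ≈ w
pos-cong⁻¹ v w eq i =
  pos-injective w (trans (sym (eq _)) (trans (inverseˡ v) (sym (inverseˡ w))))

-- Inversions are recorded by letters, not positions: right multiplication by a generator exchanges
-- two neighbouring positions, hence adds or removes a single pair of letters.
record Inv (w : Permutation′ n) (a b : Fin n) : Set where
  constructor _,_
  field
    ascending : a < b
    reversed  : pos w b < pos w a

open Inv

infix 4 _⊑_

_⊑_ : Permutation′ n → Permutation′ n → Set
v ⊑ w = ∀ a b → Inv v a b → Inv w a b

inv? : (w : Permutation′ n) (a b : Fin n) → Dec (Inv w a b)
inv? w a b = map′ (λ (p , q) → p , q) (λ (p , q) → p , q)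
  ((a Fin.<? b) ×-dec (pos w b Fin.<? pos w a))

inv : Permutation′ n → ℕ
inv w = sum λ a → sum λ b → indicator (inv? w a b)

inv-mono : {v w : Permutation′ n} → v ⊑ w → inv v ℕ.≤ inv w
inv-mono {v = v} {w} v⊑w = sum-mono-≤ λ a → sum-mono-≤ λ b →
  indicator-mono (inv? v a b) (inv? w a b) (v⊑w a b)

≈⇒⊑ : (v w : Permutation′ n) → v ≈ w → v ⊑ w
≈⇒⊑ v w v≈w a b (a<b , b<a) = a<b , subst₂ _<_ (pos-cong v w v≈w b) (pos-cong v w v≈w a) b<a

inv-cong : (v w : Permutation′ n) → v ≈ w → inv v ≡ inv w
inv-cong v w v≈w = ℕ.≤-antisym (inv-mono (≈⇒⊑ v w v≈w)) (inv-mono (≈⇒⊑ w v λ i → sym (v≈w i)))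

¬Inv-pos : (w : Permutation′ n) {a b : Fin n} → a < b → ¬ Inv w a b → pos w a < pos w b
¬Inv-pos w {a} {b} a<b ¬i with <-cmp (pos w a) (pos w b)
... | tri< lt _ _ = lt
... | tri≈ _ eq _ = contradiction a<b (ℕ.<-irrefl (cong toℕ (pos-injective w eq)))
... | tri> _ _ gt = contradiction (a<b , gt) ¬i

inv-suc : {v w : Permutation′ n} {a b : Fin n} → v ⊑ w → ¬ Inv v a b → Inv w a b →
          (∀ {x y} → Inv w x y → Inv v x y ⊎ (x ≡ a × y ≡ b)) → inv w ≡ suc (inv v)
inv-suc {v = v} {w} {a} {b} v⊑w ¬iv iw w⊑v =
  sum-suc a row (sum-suc b cell (trans (indicator-yes (inv? w a b) iw)
    (cong suc (sym (indicator-no (inv? v a b) ¬iv)))))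
  where
  cell : ∀ y → y ≢ b → indicator (inv? w a y) ≡ indicator (inv? v a y)
  cell y y≢b = indicator-cong (inv? w a y) (inv? v a y)
    (λ i → [ (λ j → j) , (λ (_ , eq) → contradiction eq y≢b) ]′ (w⊑v i)) (v⊑w _ _)
  row : ∀ x → x ≢ a → sum (λ y → indicator (inv? w x y)) ≡ sum (λ y → indicator (inv? v x y))
  row x x≢a = ℕ.≤-antisym
    (sum-mono-≤ λ y → indicator-mono (inv? w x y) (inv? v x y)
      (λ i → [ (λ j → j) , (λ (eq , _) → contradiction eq x≢a) ]′ (w⊑v i)))
    (sum-mono-≤ λ y → indicator-mono (inv? v x y) (inv? w x y) (v⊑w x y))

-- Weak order and inversion sets

-- `σ i ∘ₚ w` exchanges the neighbouring entries `a` and `b` of `w`. Nothing stands between them, so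
-- every other pair keeps its order and exactly one inversion is gained.
module Ascent (w : Permutation′ (suc n)) (i : Fin n)
              (asc : w ⟨$⟩ʳ inject₁ i < w ⟨$⟩ʳ suc i) where

  private
    a b : Fin (suc n)
    a = w ⟨$⟩ʳ inject₁ i
    b = w ⟨$⟩ʳ suc i

  pos-a : pos w a ≡ inject₁ i
  pos-a = inverseˡ w

  pos-b : pos w b ≡ suc i
  pos-b = inverseˡ w

  ⊑-ascent : w ⊑ (σ i ∘ₚ w)
  ⊑-ascent x y (x<y , y<x) = x<y , τ-mono-< i y<x λ (y≡ , x≡) →
    ℕ.<-asym x<y (subst₂ _<_ (pos-injective w (trans pos-a (sym y≡)))
                             (pos-injective w (trans pos-b (sym x≡))) asc)

  ascent-new : Inv (σ i ∘ₚ w) a b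
  ascent-new = asc , subst₂ _<_ (sym (trans (cong (τ i) pos-b) (τ-suc i)))
                                (sym (trans (cong (τ i) pos-a) (τ-inject₁ i))) (inject₁<suc i)

  ¬ascent-old : ¬ Inv w a b
  ¬ascent-old (_ , b<a) = ℕ.<-asym (inject₁<suc i) (subst₂ _<_ pos-b pos-a b<a)

  ascent-⊑ : ∀ {x y} → Inv (σ i ∘ₚ w) x y → Inv w x y ⊎ (x ≡ a × y ≡ b)
  ascent-⊑ {x} {y} (x<y , y<x)
    with τ i (pos w y) Fin.≟ inject₁ i | τ i (pos w x) Fin.≟ suc i
  ... | yes y≡ | yes x≡ = inj₂
    ( pos-injective w (trans (sym (τ-involutive i _))
        (trans (cong (τ i) x≡) (trans (τ-suc i) (sym pos-a))))
    , pos-injective w (trans (sym (τ-involutive i _))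
        (trans (cong (τ i) y≡) (trans (τ-inject₁ i) (sym pos-b)))))
  ... | no y≢  | _      = inj₁ (x<y , subst₂ _<_ (τ-involutive i _) (τ-involutive i _)
                                        (τ-mono-< i y<x (y≢ ∘ proj₁)))
  ... | _      | no x≢  = inj₁ (x<y , subst₂ _<_ (τ-involutive i _) (τ-involutive i _)
                                        (τ-mono-< i y<x (x≢ ∘ proj₂)))

  inv-ascent : inv (σ i ∘ₚ w) ≡ suc (inv w)
  inv-ascent = inv-suc ⊑-ascent ¬ascent-old ascent-new ascent-⊑

σσ : (w : Permutation′ (suc n)) (i : Fin n) → (σ i ∘ₚ (σ i ∘ₚ w)) ≈ w
σσ w i x = cong (w ⟨$⟩ʳ_) (trans (cong (σ i ⟨$⟩ʳ_) (σ≡τ i x))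
             (trans (σ≡τ i (τ i x)) (τ-involutive i x)))

ascent-or-descent : (w : Permutation′ (suc n)) (i : Fin n) →
  w ⟨$⟩ʳ inject₁ i < w ⟨$⟩ʳ suc i ⊎ w ⟨$⟩ʳ suc i < w ⟨$⟩ʳ inject₁ i
ascent-or-descent w i with <-cmp (w ⟨$⟩ʳ inject₁ i) (w ⟨$⟩ʳ suc i)
... | tri< lt _ _ = inj₁ lt
... | tri≈ _ eq _ = contradiction
  (trans (sym (inverseˡ w)) (trans (cong (pos w) eq) (inverseˡ w))) (inject₁≢suc i)
... | tri> _ _ gt = inj₂ gt

σ∘-ascent : (w : Permutation′ (suc n)) (i : Fin n) → w ⟨$⟩ʳ suc i < w ⟨$⟩ʳ inject₁ i →
            (σ i ∘ₚ w) ⟨$⟩ʳ inject₁ i < (σ i ∘ₚ w) ⟨$⟩ʳ suc i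
σ∘-ascent w i desc = subst₂ _<_
  (cong (w ⟨$⟩ʳ_) (sym (trans (σ≡τ i (inject₁ i)) (τ-inject₁ i))))
  (cong (w ⟨$⟩ʳ_) (sym (trans (σ≡τ i (suc i)) (τ-suc i)))) desc

inv-descent : (w : Permutation′ (suc n)) (i : Fin n) → w ⟨$⟩ʳ suc i < w ⟨$⟩ʳ inject₁ i →
              inv w ≡ suc (inv (σ i ∘ₚ w))
inv-descent w i desc = trans (inv-cong w (σ i ∘ₚ (σ i ∘ₚ w)) (λ x → sym (σσ w i x)))
  (Ascent.inv-ascent (σ i ∘ₚ w) i (σ∘-ascent w i desc))

inv-step : (w : Permutation′ (suc n)) (i : Fin n) → inv (σ i ∘ₚ w) ℕ.≤ suc (inv w)
inv-step w i with ascent-or-descent w i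
... | inj₁ asc  = ℕ.≤-reflexive (Ascent.inv-ascent w i asc)
... | inj₂ desc = ℕ.m≤n⇒m≤1+n (ℕ.≤-trans (ℕ.n≤1+n _) (ℕ.≤-reflexive (sym (inv-descent w i desc))))

inv-product-∘ : (t : List (Fin n)) (w : Permutation′ (suc n)) →
                inv (product t ∘ₚ w) ℕ.≤ length t + inv w
inv-product-∘ []      w = ℕ.≤-refl
inv-product-∘ (i ∷ t) w = ℕ.≤-trans (inv-product-∘ t (σ i ∘ₚ w))
  (ℕ.≤-trans (ℕ.+-monoʳ-≤ (length t) (inv-step w i)) (ℕ.≤-reflexive (ℕ.+-suc (length t) (inv w))))

-- A letter adds at most one inversion, so under this bound every letter of `t` must act as an
-- ascent; one descent would already leave the total too small.
⊑-product-∘ : (t : List (Fin n)) (w : Permutation′ (suc n)) →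
              length t + inv w ℕ.≤ inv (product t ∘ₚ w) → w ⊑ (product t ∘ₚ w)
⊑-product-∘ []      w _  a b i = i
⊑-product-∘ (j ∷ t) w le with ascent-or-descent w j
... | inj₁ asc  = λ a b i → ⊑-product-∘ t (σ j ∘ₚ w)
  (ℕ.≤-trans (ℕ.≤-reflexive (trans (cong (length t +_) (Ascent.inv-ascent w j asc))
    (ℕ.+-suc _ _))) le)
  a b (Ascent.⊑-ascent w j asc a b i)
... | inj₂ desc = contradiction (ℕ.≤-trans le (inv-product-∘ t (σ j ∘ₚ w)))
  (ℕ.<⇒≱ (s≤s (ℕ.+-monoʳ-≤ (length t)
    (ℕ.≤-trans (ℕ.n≤1+n _) (ℕ.≤-reflexive (sym (inv-descent w j desc)))))))

inv-id : ∀ n → inv (id {n}) ≡ 0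
inv-id n = sum-zero λ a → sum-zero λ b →
  indicator-no (inv? (id {n}) a b) λ (p , q) → ℕ.<-asym p q

-- Climbing from the first index gives `i ≤ f i`, and descending from the last one gives `f i ≤ i`.
increasing⇒id : (f : Fin (suc n) → Fin (suc n)) → (∀ (i : Fin n) → f (inject₁ i) < f (suc i)) →
                ∀ i → f i ≡ i
increasing⇒id {n} f inc i = toℕ-injective
  (ℕ.≤-antisym (upper _ i (ℕ.m∸n+n≡m (ℕ.s≤s⁻¹ (Fin.toℕ<n i)))) (lower i))
  where
  lower : ∀ i → toℕ i ℕ.≤ toℕ (f i)
  lower i = go _ i refl
    where
    go : ∀ m (i : Fin (suc n)) → toℕ i ≡ m → m ℕ.≤ toℕ (f i)
    go zero    i       eq = z≤n
    go (suc m) (suc i) eq = ℕ.≤-trans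
      (s≤s (go m (inject₁ i) (trans (toℕ-inject₁ i) (ℕ.suc-injective eq)))) (inc i)
  upper : ∀ d (i : Fin (suc n)) → d + toℕ i ≡ n → toℕ (f i) ℕ.≤ toℕ i
  upper zero    i eq = ℕ.≤-trans (ℕ.s≤s⁻¹ (Fin.toℕ<n (f i))) (ℕ.≤-reflexive (sym eq))
  upper (suc d) i eq = ℕ.s≤s⁻¹ (ℕ.≤-trans (subst (λ x → f x < f (suc j)) inj-j (inc j))
    (ℕ.≤-trans (upper d (suc j) (trans (cong (λ x → d + suc x) toℕ-j) (trans (ℕ.+-suc d _) eq)))
               (ℕ.≤-reflexive (cong suc toℕ-j))))
    where
    i<n : toℕ i ℕ.< n
    i<n = ℕ.≤-trans (s≤s (ℕ.m≤n+m _ d)) (ℕ.≤-reflexive eq)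
    j : Fin n
    j = fromℕ< i<n
    toℕ-j : toℕ j ≡ toℕ i
    toℕ-j = Fin.toℕ-fromℕ< i<n
    inj-j : inject₁ j ≡ i
    inj-j = toℕ-injective (trans (toℕ-inject₁ j) toℕ-j)

-- A maximal chain from v to w: as long as v ≠ w, some ascent of v is an inversion of w.
⊑⇒suffix : ∀ d (v w : Permutation′ (suc n)) → v ⊑ w → inv w ℕ.≤ d + inv v →
           ∃ λ t → (product t ∘ₚ v) ≈ w × length t + inv v ≡ inv w
⊑⇒suffix {n} d v w v⊑w bound with Fin.any? (λ i →
  ((v ⟨$⟩ʳ inject₁ i) Fin.<? (v ⟨$⟩ʳ suc i)) ×-dec inv? w (v ⟨$⟩ʳ inject₁ i) (v ⟨$⟩ʳ suc i))
... | no ¬step = [] , v≈w , inv-cong v w v≈w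
  where
  -- Ascents of `v` are now non-inversions of `w`, and descents of `v` are inversions of `w`; so
  -- reading `v` from left to right, the positions in `w` increase.
  increasing : ∀ i → pos w (v ⟨$⟩ʳ inject₁ i) < pos w (v ⟨$⟩ʳ suc i)
  increasing i with ascent-or-descent v i
  ... | inj₁ asc  = ¬Inv-pos w asc λ inv → ¬step (i , asc , inv)
  ... | inj₂ desc = reversed (v⊑w _ _
    (desc , subst₂ _<_ (sym (inverseˡ v)) (sym (inverseˡ v)) (inject₁<suc i)))
  v≈w : v ≈ w
  v≈w i = pos-injective w (trans (increasing⇒id _ increasing i) (sym (inverseˡ w)))
... | yes (i , asc , new) = extend d bound
  where
  v′ : Permutation′ (suc n)
  v′ = σ i ∘ₚ v
  v′⊑w : v′ ⊑ w
  v′⊑w a b inv with Ascent.ascent-⊑ v i asc inv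
  ... | inj₁ old           = v⊑w a b old
  ... | inj₂ (refl , refl) = new
  inv-v′ : inv v′ ≡ suc (inv v)
  inv-v′ = Ascent.inv-ascent v i asc
  extend : ∀ d → inv w ℕ.≤ d + inv v → ∃ λ t → (product t ∘ₚ v) ≈ w × length t + inv v ≡ inv w
  -- `d` bounds the number of inversions still missing from `v`; as `v′` has gained one, `d` cannot
  -- be zero.
  extend zero    bound = contradiction (ℕ.≤-trans (inv-mono v′⊑w) bound)
                                       (ℕ.<⇒≱ (ℕ.≤-reflexive (sym inv-v′)))
  extend (suc d) bound =
    let t , eq , len = ⊑⇒suffix d v′ w v′⊑w
          (ℕ.≤-trans bound (ℕ.≤-reflexive (sym (trans (cong (d +_) inv-v′) (ℕ.+-suc d _)))))
    in i ∷ t , eq , trans (sym (ℕ.+-suc _ _)) (trans (cong (length t +_) (sym inv-v′)) len)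

inv-product : (t : List (Fin n)) → inv (product t) ℕ.≤ length t
inv-product {n} t = ℕ.≤-trans (inv-product-∘ t id)
  (ℕ.≤-reflexive (trans (cong (length t +_) (inv-id (suc n))) (ℕ.+-identityʳ _)))

reduced : (s : List (Fin n)) (w : Permutation′ (suc n)) → product s ≈ w → length s ≡ inv w →
          ReducedDecomposition s w
reduced s w eq len = record
  { product≈ = eq
  ; minimal  = λ t eq′ → ℕ.≤-trans
      (ℕ.≤-reflexive (trans len (inv-cong w (product t) λ i → sym (eq′ i)))) (inv-product t)
  }

reduced-word : (w : Permutation′ (suc n)) → ∃ λ s → product s ≈ w × length s ≡ inv w
reduced-word {n} w =
  let s , eq , len = ⊑⇒suffix (inv w) (id {suc n}) w
        (λ _ _ (p , q) → contradiction q (ℕ.<-asym p)) (ℕ.m≤m+n _ _)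
  in s , eq , trans (sym (trans (cong (length s +_) (inv-id (suc n))) (ℕ.+-identityʳ _))) len

reduced-length : (s : List (Fin n)) (w : Permutation′ (suc n)) →
                 ReducedDecomposition s w → length s ≡ inv w
reduced-length s w r with t , eq , len ← reduced-word w = ℕ.≤-antisym
  (ℕ.≤-trans (minimal t eq) (ℕ.≤-reflexive len))
  (ℕ.≤-trans (ℕ.≤-reflexive (inv-cong w (product s) λ i → sym (product≈ i))) (inv-product s))
  where open ReducedDecomposition r

product-++ : (s t : List (Fin n)) → product (s ++ t) ≈ (product t ∘ₚ product s)
product-++ []      t x = refl
product-++ (i ∷ s) t x = cong (σ i ⟨$⟩ʳ_) (product-++ s t x)

prefix-++ : ∀ {A : Set} (s t : List A) → Prefix _≡_ s (s ++ t)
prefix-++ []      t = []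
prefix-++ (x ∷ s) t = refl ∷ prefix-++ s t

++-prefix : ∀ {A : Set} {s t : List A} → Prefix _≡_ s t → ∃ λ r → t ≡ s ++ r
++-prefix {t = t} [] = t , refl
++-prefix (refl ∷ p) with r , refl ← ++-prefix p = r , refl

-- A reduced word of `v` followed by a chain from `v` to `w` has length `inv w`, so it is again
-- reduced.
⊑⇒≤wk : {v w : Permutation′ (suc n)} → v ⊑ w → v ≤wk w
⊑⇒≤wk {v = v} {w} v⊑w =
  let s , s≈v , len-s = reduced-word v
      t , tv≈w , len-t = ⊑⇒suffix (inv w) v w v⊑w (ℕ.m≤m+n _ _)
  in s , s ++ t , reduced s v s≈v len-s
   , reduced (s ++ t) w
       (λ i → trans (product-++ s t i) (trans (s≈v _) (tv≈w i)))
       (trans (length-++ s) (trans (ℕ.+-comm (length s) _)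
         (trans (cong (length t +_) len-s) len-t)))
   , prefix-++ s t

-- Reduced words have the inversion number as length, so the part of `t` beyond `s` adds one
-- inversion per letter and `⊑-product-∘` applies.
≤wk⇒⊑ : {v w : Permutation′ (suc n)} → v ≤wk w → v ⊑ w
≤wk⇒⊑ {v = v} {w} (s , t , rs , rt , p) with r , refl ← ++-prefix p = λ a b i →
  ≈⇒⊑ (product r ∘ₚ product s) w rs≈w a b
    (⊑-product-∘ r (product s) (ℕ.≤-reflexive len) a b
      (≈⇒⊑ v (product s) (λ i → sym (s≈v i)) a b i))
  where
  rs≈w : (product r ∘ₚ product s) ≈ w
  rs≈w i = trans (sym (product-++ s r i)) (ReducedDecomposition.product≈ rt i)
  s≈v : product s ≈ v
  s≈v = ReducedDecomposition.product≈ rs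
  len : length r + inv (product s) ≡ inv (product r ∘ₚ product s)
  len = begin
    length r + inv (product s)     ≡⟨ cong (length r +_) (inv-cong (product s) v s≈v) ⟩
    length r + inv v               ≡⟨ cong (length r +_) (reduced-length s v rs) ⟨
    length r + length s            ≡⟨ ℕ.+-comm (length r) _ ⟩
    length s + length r            ≡⟨ length-++ s ⟨
    length (s ++ r)                ≡⟨ reduced-length (s ++ r) w rt ⟩
    inv w                          ≡⟨ inv-cong (product r ∘ₚ product s) w rs≈w ⟨
    inv (product r ∘ₚ product s)   ∎
    where open ≡-Reasoning

-- Equal inversion numbers force the chain from `v` to `w` to be empty.
⊑-antisym : {v w : Permutation′ (suc n)} → v ⊑ w → w ⊑ v → v ≈ w
⊑-antisym {v = v} {w} v⊑w w⊑v with ⊑⇒suffix 0 v w v⊑w (inv-mono w⊑v)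
... | []    , v≈w , _   = v≈w
... | _ ∷ t , _   , len = contradiction (inv-mono w⊑v) (ℕ.<⇒≱
  (ℕ.≤-trans (s≤s (ℕ.m≤n+m _ (length t))) (ℕ.≤-reflexive len)))

-- Permutations with a prescribed inversion set

sum-mono-< : ∀ {n} {f g : Fin n → ℕ} i → (∀ i → f i ℕ.≤ g i) → f i ℕ.< g i → sum f ℕ.< sum g
sum-mono-< {suc n} zero    f≤g f<g = ℕ.+-mono-<-≤ f<g (sum-mono-≤ (f≤g ∘ suc))
sum-mono-< {suc n} (suc i) f≤g f<g = ℕ.+-mono-≤-< (f≤g zero) (sum-mono-< i (f≤g ∘ suc) f<g)

sum-one : ∀ n → sum {n} (λ _ → 1) ≡ n
sum-one zero    = refl
sum-one (suc n) = cong suc (sum-one n)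

-- Pigeonhole: punching out a missed value would inject `Fin (suc n)` into `Fin n`.
injective⇒surjective : (f : Fin n → Fin n) → Injective _≡_ _≡_ f → ∀ y → ∃ λ x → f x ≡ y
injective⇒surjective {suc n} f f-inj y with Fin.any? (λ x → f x Fin.≟ y)
... | yes found = found
... | no ¬found = contradiction
  (Fin.injective⇒≤ {f = λ x → punchOut (y≢f x)} (f-inj ∘ Fin.punchOut-injective (y≢f _) (y≢f _)))
  (ℕ.<⇒≱ ℕ.≤-refl)
  where
  y≢f : ∀ x → y ≢ f x
  y≢f x y≡fx = ¬found (x , sym y≡fx)

withPositions : (f : Fin n → Fin n) → Injective _≡_ _≡_ f → Permutation′ n
withPositions f f-inj = permutation (proj₁ ∘ surj) f
  (λ a → f-inj (proj₂ (surj (f a)))) (proj₂ ∘ surj)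
  where surj = injective⇒surjective f f-inj

-- A set of ascending pairs is an inversion set as soon as it and its complement among the ascending
-- pairs are transitive; `J-cotrans` is the latter condition. Together they make `Before` a strict
-- total order, and the number of predecessors serves as position.
module FromInversions
  (J : Fin n → Fin n → Set) (J? : ∀ a b → Dec (J a b))
  (J⇒< : ∀ {a b} → J a b → a < b)
  (J-trans : ∀ {a b c} → J a b → J b c → J a c)
  (J-cotrans : ∀ {a b c} → J a c → a < b → b < c → J a b ⊎ J b c)
  where

  private
    Before : Fin n → Fin n → Set
    Before a b = (a < b × ¬ J a b) ⊎ J b a

    before? : ∀ a b → Dec (Before a b)
    before? a b = ((a Fin.<? b) ×-dec ¬? (J? a b)) ⊎-dec J? b a

    before-irrefl : ∀ {a} → ¬ Before a a
    before-irrefl (inj₁ (a<a , _)) = ℕ.<-irrefl refl a<a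
    before-irrefl (inj₂ j)         = ℕ.<-irrefl refl (J⇒< j)

    before-trans : ∀ {a b c} → Before a b → Before b c → Before a c
    before-trans (inj₁ (a<b , ¬ab)) (inj₁ (b<c , ¬bc)) =
      inj₁ (ℕ.<-trans a<b b<c , λ ac → [ ¬ab , ¬bc ]′ (J-cotrans ac a<b b<c))
    before-trans {a} {c = c} (inj₁ (a<b , ¬ab)) (inj₂ cb) with <-cmp a c
    ... | tri< a<c _ _  = inj₁ (a<c , λ ac → ¬ab (J-trans ac cb))
    ... | tri≈ _ refl _ = contradiction cb ¬ab
    ... | tri> _ _ c<a  = [ inj₂ , (λ ab → contradiction ab ¬ab) ]′ (J-cotrans cb c<a a<b)
    before-trans {a} {c = c} (inj₂ ba) (inj₁ (b<c , ¬bc)) with <-cmp a c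
    ... | tri< a<c _ _  = inj₁ (a<c , λ ac → ¬bc (J-trans ba ac))
    ... | tri≈ _ refl _ = contradiction ba ¬bc
    ... | tri> _ _ c<a  = [ (λ bc → contradiction bc ¬bc) , inj₂ ]′ (J-cotrans ba b<c c<a)
    before-trans (inj₂ ba) (inj₂ cb) = inj₂ (J-trans cb ba)

    before-total : ∀ {a b} → a ≢ b → Before a b ⊎ Before b a
    before-total {a} {b} a≢b with <-cmp a b | J? a b | J? b a
    ... | tri< a<b _ _ | yes ab | _      = inj₂ (inj₂ ab)
    ... | tri< a<b _ _ | no ¬ab | _      = inj₁ (inj₁ (a<b , ¬ab))
    ... | tri≈ _ a≡b _ | _      | _      = contradiction a≡b a≢b
    ... | tri> _ _ b<a | _      | yes ba = inj₁ (inj₂ ba)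
    ... | tri> _ _ b<a | _      | no ¬ba = inj₂ (inj₁ (b<a , ¬ba))

    rank : Fin n → ℕ
    rank a = sum λ b → indicator (before? b a)

    rank-mono : ∀ {a b} → Before a b → rank a ℕ.< rank b
    rank-mono {a} {b} ab = sum-mono-< a
      (λ x → indicator-mono (before? x a) (before? x b) (λ xa → before-trans xa ab))
      (subst₂ ℕ._<_ (sym (indicator-no (before? a a) before-irrefl))
                    (sym (indicator-yes (before? a b) ab)) (s≤s z≤n))

    rank<n : ∀ a → rank a ℕ.< n
    -- `a` does not precede itself, so at least one of the `n` letters is missing from its
    -- predecessors.
    rank<n a = subst (rank a ℕ.<_) (sum-one n) (sum-mono-< a
      (λ x → indicator-mono (before? x a) (yes refl) (λ _ → refl {x = a}))
      (subst (ℕ._< 1) (sym (indicator-no (before? a a) before-irrefl)) (s≤s z≤n)))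

    position : Fin n → Fin n
    position a = fromℕ< (rank<n a)

    position-mono : ∀ {a b} → Before a b → position a < position b
    position-mono ab = subst₂ ℕ._<_ (sym (Fin.toℕ-fromℕ< _)) (sym (Fin.toℕ-fromℕ< _)) (rank-mono ab)

    position-injective : Injective _≡_ _≡_ position
    position-injective {a} {b} eq with a Fin.≟ b
    ... | yes a≡b = a≡b
    ... | no a≢b  = contradiction eq
      ([ (λ ab → Fin.<⇒≢ (position-mono ab)) , (λ ba → Fin.<⇒≢ (position-mono ba) ∘ sym) ]′
        (before-total a≢b))

  abstract
    perm : Permutation′ n
    perm = withPositions position position-injective

    J⇒Inv : ∀ {a b} → J a b → Inv perm a b
    J⇒Inv ab = J⇒< ab , position-mono (inj₂ ab)

    Inv⇒J : ∀ {a b} → Inv perm a b → J a b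
    Inv⇒J {a} {b} (a<b , rev) with J? a b
    ... | yes ab = ab
    ... | no ¬ab = contradiction rev (ℕ.<-asym (position-mono (inj₁ (a<b , ¬ab))))

Inv-trans : (w : Permutation′ n) {a b c : Fin n} → Inv w a b → Inv w b c → Inv w a c
Inv-trans w (a<b , ba) (b<c , cb) = ℕ.<-trans a<b b<c , ℕ.<-trans cb ba

Inv-cotrans : (w : Permutation′ n) {a b c : Fin n} → Inv w a c → a < b → b < c →
              Inv w a b ⊎ Inv w b c
Inv-cotrans w {a} {b} {c} (_ , ca) a<b b<c with inv? w a b
... | yes ab = inj₁ ab
... | no ¬ab = inj₂ (b<c , ℕ.<-trans ca (¬Inv-pos w a<b ¬ab))

-- Distributive intervals above a generator

IsPair : Fin n → Fin (suc n) → Fin (suc n) → Set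
IsPair k a b = a ≡ inject₁ k × b ≡ suc k

isPair? : (k : Fin n) (a b : Fin (suc n)) → Dec (IsPair k a b)
isPair? k a b = (a Fin.≟ inject₁ k) ×-dec (b Fin.≟ suc k)

Inv-σ : (k : Fin n) → Inv (σ k) (inject₁ k) (suc k)
Inv-σ k = inject₁<suc k , subst₂ _<_ (sym (τ-suc k)) (sym (τ-inject₁ k)) (inject₁<suc k)

Inv-σ⇒IsPair : (k : Fin n) {a b : Fin (suc n)} → Inv (σ k) a b → IsPair k a b
Inv-σ⇒IsPair {n} k (a<b , ba) with Ascent.ascent-⊑ (id {suc n}) k (inject₁<suc k) (a<b , ba)
... | inj₁ (p , q) = contradiction q (ℕ.<-asym p)
... | inj₂ pair    = pair

σ⊑ : {k : Fin n} {w : Permutation′ (suc n)} → Inv w (inject₁ k) (suc k) → σ k ⊑ w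
σ⊑ {k = k} {w} i a b ab with refl , refl ← Inv-σ⇒IsPair k ab = i

≤wk-isPartialOrder : IsPartialOrder (_≈_ {suc n} {suc n}) _≤wk_
≤wk-isPartialOrder {n} = record
  { isPreorder = record
    { isEquivalence = Setoid.isEquivalence (permutationSetoid (suc n))
    ; reflexive     = λ {v} {w} v≈w → ⊑⇒≤wk (≈⇒⊑ v w v≈w)
    ; trans         = λ u≤v v≤w → ⊑⇒≤wk λ a b i → ≤wk⇒⊑ v≤w a b (≤wk⇒⊑ u≤v a b i)
    }
  ; antisym = λ v≤w w≤v → ⊑-antisym (≤wk⇒⊑ v≤w) (≤wk⇒⊑ w≤v)
  }

-- For σ k ≤wk w this says that w ∘ₚ σ k avoids 321.
NoOther321 : Fin n → Permutation′ (suc n) → Set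
NoOther321 k w = ∀ {a b c} → Inv w a b → Inv w b c → IsPair k a b ⊎ IsPair k b c

module Distributive (k : Fin n) (w : Permutation′ (suc n)) (no321 : NoOther321 k w) where

  private
    I : Set
    I = Interval (σ k) w

    _∈_ : Fin (suc n) × Fin (suc n) → I → Set
    (a , b) ∈ (u , _) = Inv u a b

    pair∈ : ∀ x {a b} → IsPair k a b → (a , b) ∈ x
    pair∈ (u , σk≤u , _) (refl , refl) = ≤wk⇒⊑ σk≤u _ _ (Inv-σ k)

    ∈⇒Inv : ∀ x {a b} → (a , b) ∈ x → Inv w a b
    ∈⇒Inv (u , _ , u≤w) = ≤wk⇒⊑ u≤w _ _

    -- The delicate case has `(a , b)` in one set and `(b , c)` in the other. Then `a`, `b`, `c`
    -- form a 321-pattern of `w`, so one of these pairs is that of `σ k`, which lies in both sets.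
    ∩-cotrans : ∀ x y {a b c} → (a , c) ∈ x × (a , c) ∈ y → a < b → b < c →
                ((a , b) ∈ x × (a , b) ∈ y) ⊎ ((b , c) ∈ x × (b , c) ∈ y)
    ∩-cotrans x y (i , i′) a<b b<c
      with Inv-cotrans (proj₁ x) i a<b b<c | Inv-cotrans (proj₁ y) i′ a<b b<c
    ... | inj₁ j | inj₁ j′ = inj₁ (j , j′)
    ... | inj₂ j | inj₂ j′ = inj₂ (j , j′)
    ... | inj₁ j | inj₂ j′ = [ (λ p → inj₁ (j , pair∈ y p)) , (λ p → inj₂ (pair∈ x p , j′)) ]′
                               (no321 (∈⇒Inv x j) (∈⇒Inv y j′))
    ... | inj₂ j | inj₁ j′ = [ (λ p → inj₁ (pair∈ x p , j′)) , (λ p → inj₂ (j , pair∈ y p)) ]′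
                               (no321 (∈⇒Inv y j′) (∈⇒Inv x j))

    -- If the two pairs come from different sets, one of them is the pair of `σ k` and hence lies in
    -- the other set too, where transitivity applies.
    ∪-trans : ∀ x y {a b c} → (a , b) ∈ x ⊎ (a , b) ∈ y → (b , c) ∈ x ⊎ (b , c) ∈ y →
              (a , c) ∈ x ⊎ (a , c) ∈ y
    ∪-trans x y (inj₁ i) (inj₁ j) = inj₁ (Inv-trans (proj₁ x) i j)
    ∪-trans x y (inj₂ i) (inj₂ j) = inj₂ (Inv-trans (proj₁ y) i j)
    ∪-trans x y (inj₁ i) (inj₂ j) =
      [ (λ p → inj₂ (Inv-trans (proj₁ y) (pair∈ y p) j))
      , (λ p → inj₁ (Inv-trans (proj₁ x) i (pair∈ x p))) ]′ (no321 (∈⇒Inv x i) (∈⇒Inv y j))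
    ∪-trans x y (inj₂ i) (inj₁ j) =
      [ (λ p → inj₁ (Inv-trans (proj₁ x) (pair∈ x p) j))
      , (λ p → inj₂ (Inv-trans (proj₁ y) i (pair∈ y p))) ]′ (no321 (∈⇒Inv y i) (∈⇒Inv x j))

    ∪-cotrans : ∀ x y {a b c} → (a , c) ∈ x ⊎ (a , c) ∈ y → a < b → b < c →
                ((a , b) ∈ x ⊎ (a , b) ∈ y) ⊎ ((b , c) ∈ x ⊎ (b , c) ∈ y)
    ∪-cotrans x y (inj₁ i) a<b b<c =
      [ inj₁ ∘ inj₁ , inj₂ ∘ inj₁ ]′ (Inv-cotrans (proj₁ x) i a<b b<c)
    ∪-cotrans x y (inj₂ i) a<b b<c =
      [ inj₁ ∘ inj₂ , inj₂ ∘ inj₂ ]′ (Inv-cotrans (proj₁ y) i a<b b<c)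

    module Meet (x y : I) = FromInversions
      (λ a b → (a , b) ∈ x × (a , b) ∈ y)
      (λ a b → inv? (proj₁ x) a b ×-dec inv? (proj₁ y) a b)
      (λ (i , _) → ascending i)
      (λ (i , i′) (j , j′) → Inv-trans (proj₁ x) i j , Inv-trans (proj₁ y) i′ j′)
      (∩-cotrans x y)

    module Join (x y : I) = FromInversions
      (λ a b → (a , b) ∈ x ⊎ (a , b) ∈ y)
      (λ a b → inv? (proj₁ x) a b ⊎-dec inv? (proj₁ y) a b)
      [ ascending , ascending ]′ (∪-trans x y) (∪-cotrans x y)

    ≤⇒⊆ : ∀ x y → proj₁ x ≤wk proj₁ y → ∀ {e} → e ∈ x → e ∈ y
    ≤⇒⊆ x y x≤y = ≤wk⇒⊑ x≤y _ _

    abstract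
      _∧_ _∨_ : I → I → I
      x ∧ y = Meet.perm x y
            , ⊑⇒≤wk (σ⊑ (Meet.J⇒Inv x y (pair∈ x (refl , refl) , pair∈ y (refl , refl))))
            , ⊑⇒≤wk (λ a b i → ∈⇒Inv x (proj₁ (Meet.Inv⇒J x y i)))
      x ∨ y = Join.perm x y
            , ⊑⇒≤wk (σ⊑ (Join.J⇒Inv x y (inj₁ (pair∈ x (refl , refl)))))
            , ⊑⇒≤wk (λ a b i → [ ∈⇒Inv x , ∈⇒Inv y ]′ (Join.Inv⇒J x y i))

      ∈-∧ : ∀ x y {e} → e ∈ x → e ∈ y → e ∈ (x ∧ y)
      ∈-∧ x y i j = Meet.J⇒Inv x y (i , j)

      ∧-∈ : ∀ x y {e} → e ∈ (x ∧ y) → e ∈ x × e ∈ y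
      ∧-∈ x y = Meet.Inv⇒J x y

      ∈-∨ : ∀ x y {e} → e ∈ x ⊎ e ∈ y → e ∈ (x ∨ y)
      ∈-∨ x y = Join.J⇒Inv x y

      ∨-∈ : ∀ x y {e} → e ∈ (x ∨ y) → e ∈ x ⊎ e ∈ y
      ∨-∈ x y = Join.Inv⇒J x y

  distributive : DistributiveInterval (σ k) w
  distributive = _∨_ , _∧_ , record
    { isLattice = record
      { isPartialOrder = On.isPartialOrder proj₁ ≤wk-isPartialOrder
      ; supremum = λ x y → ⊑⇒≤wk (λ _ _ → ∈-∨ x y ∘ inj₁) , ⊑⇒≤wk (λ _ _ → ∈-∨ x y ∘ inj₂)
          , λ z x≤z y≤z → ⊑⇒≤wk (λ _ _ → [ ≤⇒⊆ x z x≤z , ≤⇒⊆ y z y≤z ]′ ∘ ∨-∈ x y)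
      ; infimum = λ x y → ⊑⇒≤wk (λ _ _ → proj₁ ∘ ∧-∈ x y) , ⊑⇒≤wk (λ _ _ → proj₂ ∘ ∧-∈ x y)
          , λ z z≤x z≤y → ⊑⇒≤wk (λ _ _ i → ∈-∧ x y (≤⇒⊆ z x z≤x i) (≤⇒⊆ z y z≤y i))
      }
    ; ∧-distribˡ-∨ = λ x y z → ⊑-antisym
        (λ a b i → let i₁ , i₂ = ∧-∈ x (y ∨ z) i in ∈-∨ (x ∧ y) (x ∧ z)
          ([ (λ j → inj₁ (∈-∧ x y i₁ j)) , (λ j → inj₂ (∈-∧ x z i₁ j)) ]′ (∨-∈ y z i₂)))
        (λ a b i → [ (λ j → let j₁ , j₂ = ∧-∈ x y j in ∈-∧ x (y ∨ z) j₁ (∈-∨ y z (inj₁ j₂)))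
                   , (λ j → let j₁ , j₂ = ∧-∈ x z j in ∈-∧ x (y ∨ z) j₁ (∈-∨ y z (inj₂ j₂))) ]′
                   (∨-∈ (x ∧ y) (x ∧ z) i))
    }

-- Modular intervals

-- `w` arises from `σ i ∘ₚ w` by an ascent at `i`, so `Ascent` read backwards shows that undoing the
-- descent loses exactly one inversion.
module Descent (w : Permutation′ (suc n)) (i : Fin n)
               (desc : w ⟨$⟩ʳ suc i < w ⟨$⟩ʳ inject₁ i) where

  private
    v : Permutation′ (suc n)
    v = σ i ∘ₚ w

    v-low : v ⟨$⟩ʳ inject₁ i ≡ w ⟨$⟩ʳ suc i
    v-low = cong (w ⟨$⟩ʳ_) (trans (σ≡τ i (inject₁ i)) (τ-inject₁ i))

    v-high : v ⟨$⟩ʳ suc i ≡ w ⟨$⟩ʳ inject₁ i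
    v-high = cong (w ⟨$⟩ʳ_) (trans (σ≡τ i (suc i)) (τ-suc i))

    asc : v ⟨$⟩ʳ inject₁ i < v ⟨$⟩ʳ suc i
    asc = σ∘-ascent w i desc

  ⊑-descent : v ⊑ w
  ⊑-descent a b j = ≈⇒⊑ (σ i ∘ₚ v) w (σσ w i) a b (Ascent.⊑-ascent v i asc a b j)

  descent-⊑ : ∀ {a b} → Inv w a b → Inv v a b ⊎ (a ≡ w ⟨$⟩ʳ suc i × b ≡ w ⟨$⟩ʳ inject₁ i)
  descent-⊑ {a} {b} j
    with Ascent.ascent-⊑ v i asc (≈⇒⊑ w (σ i ∘ₚ v) (λ x → sym (σσ w i x)) a b j)
  ... | inj₁ old         = inj₁ old
  ... | inj₂ (a≡ , b≡) = inj₂ (trans a≡ v-low , trans b≡ v-high)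

  ¬descent-new : ¬ Inv v (w ⟨$⟩ʳ suc i) (w ⟨$⟩ʳ inject₁ i)
  ¬descent-new j = Ascent.¬ascent-old v i asc (subst₂ (Inv v) (sym v-low) (sym v-high) j)

-- If only the two named pairs descend between the positions of y and x, then the
-- values stay ≥ y up to a descent (suc k , k), and ≥ k after it.
adjacent : (k : Fin n) (v : Permutation′ (suc n)) {x y : Fin (suc n)} → Inv v x y →
  (∀ j → pos v y Fin.≤ inject₁ j → suc j Fin.≤ pos v x → v ⟨$⟩ʳ suc j < v ⟨$⟩ʳ inject₁ j →
     (v ⟨$⟩ʳ suc j ≡ x × v ⟨$⟩ʳ inject₁ j ≡ y) ⊎ IsPair k (v ⟨$⟩ʳ suc j) (v ⟨$⟩ʳ inject₁ j)) →
  ¬ IsPair k x y → ∃ λ j → v ⟨$⟩ʳ suc j ≡ x × v ⟨$⟩ʳ inject₁ j ≡ y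
adjacent {n} k v {x} {y} (x<y , y⇠x) descents ¬pair =
  finish (walk (toℕ (pos v x) ∸ toℕ (pos v y)) (pos v x) (ℕ.m∸n+n≡m (ℕ.<⇒≤ y⇠x)) ℕ.≤-refl)
  where
  Adjacent : Set
  Adjacent = ∃ λ j → v ⟨$⟩ʳ suc j ≡ x × v ⟨$⟩ʳ inject₁ j ≡ y
  Invariant : Fin (suc n) → Set
  Invariant q = y Fin.≤ v ⟨$⟩ʳ q ⊎ (y Fin.≤ suc k × inject₁ k Fin.≤ v ⟨$⟩ʳ q)
  walk : ∀ m q → m + toℕ (pos v y) ≡ toℕ q → q Fin.≤ pos v x → Adjacent ⊎ Invariant q
  walk zero q eq _ = inj₂ (inj₁ (ℕ.≤-reflexive (cong toℕ
    (trans (sym (inverseʳ v)) (cong (v ⟨$⟩ʳ_) (toℕ-injective eq))))))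
  walk (suc m) (suc j) eq q≤x
    with walk m (inject₁ j) (trans (ℕ.suc-injective eq) (sym (toℕ-inject₁ j))) (ℕ.<⇒≤ (ℕ.≤-trans (inject₁<suc j) q≤x))
  ... | inj₁ adj = inj₁ adj
  ... | inj₂ invariant with ascent-or-descent v j
  ...   | inj₁ asc = inj₂ (ascend invariant)
    where
    ascend : Invariant (inject₁ j) → Invariant (suc j)
    ascend (inj₁ y≤)         = inj₁ (ℕ.≤-trans y≤ (ℕ.<⇒≤ asc))
    ascend (inj₂ (y≤ , k≤)) = inj₂ (y≤ , ℕ.≤-trans k≤ (ℕ.<⇒≤ asc))
  ...   | inj₂ desc with descents j (ℕ.≤-trans (ℕ.m≤n+m _ m)
                           (ℕ.≤-reflexive (trans (ℕ.suc-injective eq) (sym (toℕ-inject₁ j))))) q≤x desc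
  ...     | inj₁ adj        = inj₁ (j , adj)
  ...     | inj₂ (v≡k , v≡1+k) = inj₂ (inj₂ (y≤1+k invariant , ℕ.≤-reflexive (cong toℕ (sym v≡k))))
    where
    y≤1+k : Invariant (inject₁ j) → y Fin.≤ suc k
    y≤1+k (inj₁ y≤)       = ℕ.≤-trans y≤ (ℕ.≤-reflexive (cong toℕ v≡1+k))
    y≤1+k (inj₂ (y≤ , _)) = y≤
  finish : Adjacent ⊎ Invariant (pos v x) → Adjacent
  finish (inj₁ adj)              = adj
  finish (inj₂ (inj₁ y≤x))       =
    contradiction (ℕ.≤-trans y≤x (ℕ.≤-reflexive (cong toℕ (inverseʳ v)))) (ℕ.<⇒≱ x<y)
  -- Here `k ≤ x < y ≤ k + 1`, which makes `(x , y)` the excluded pair.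
  finish (inj₂ (inj₂ (y≤1+k , k≤x))) = contradiction (toℕ-injective x≡k , toℕ-injective y≡1+k) ¬pair
    where
    k≤x′ : toℕ k ℕ.≤ toℕ x
    k≤x′ = subst₂ ℕ._≤_ (toℕ-inject₁ k) (cong toℕ (inverseʳ v)) k≤x
    y≡1+k : toℕ y ≡ suc (toℕ k)
    y≡1+k = ℕ.≤-antisym y≤1+k (ℕ.≤-trans (s≤s k≤x′) x<y)
    x≡k : toℕ x ≡ toℕ (inject₁ k)
    x≡k = trans (ℕ.≤-antisym (ℕ.s≤s⁻¹ (ℕ.≤-trans x<y y≤1+k)) k≤x′) (sym (toℕ-inject₁ k))

-- An element of the interval in which `c`, `b`, `a` stand side by side in this order; the place of
-- `b` is both `suc i` and `inject₁ j`.
record Consecutive321 (k : Fin n) (w : Permutation′ (suc n)) (a b c : Fin (suc n)) : Set where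
  field
    v    : Permutation′ (suc n)
    v⊑w  : v ⊑ w
    σ∈v  : Inv v (inject₁ k) (suc k)
    a<b  : a < b
    b<c  : b < c
    i j  : Fin n
    vi≡c : v ⟨$⟩ʳ inject₁ i ≡ c
    vi≡b : v ⟨$⟩ʳ suc i ≡ b
    vj≡b : v ⟨$⟩ʳ inject₁ j ≡ b
    vj≡a : v ⟨$⟩ʳ suc j ≡ a

-- The descents that may not be undone: the two steps of the pattern, and the one that keeps the
-- permutation above `σ k`.
Protected : Fin n → Permutation′ (suc n) → (a b c : Fin (suc n)) → Fin n → Set
Protected k w a b c i =
  (w ⟨$⟩ʳ suc i ≡ a × w ⟨$⟩ʳ inject₁ i ≡ b) ⊎
  (w ⟨$⟩ʳ suc i ≡ b × w ⟨$⟩ʳ inject₁ i ≡ c) ⊎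
  IsPair k (w ⟨$⟩ʳ suc i) (w ⟨$⟩ʳ inject₁ i)

protected? : (k : Fin n) (w : Permutation′ (suc n)) (a b c : Fin (suc n)) (i : Fin n) →
             Dec (Protected k w a b c i)
protected? k w a b c i =
  (((w ⟨$⟩ʳ suc i) Fin.≟ a) ×-dec ((w ⟨$⟩ʳ inject₁ i) Fin.≟ b)) ⊎-dec
  (((w ⟨$⟩ʳ suc i) Fin.≟ b) ×-dec ((w ⟨$⟩ʳ inject₁ i) Fin.≟ c)) ⊎-dec
  isPair? k (w ⟨$⟩ʳ suc i) (w ⟨$⟩ʳ inject₁ i)

-- Undo descents as long as this keeps the 321-pattern and stays above σ k.
consecutive321 : ∀ d (k : Fin n) (w : Permutation′ (suc n)) {a b c} → inv w ℕ.≤ d →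
  Inv w (inject₁ k) (suc k) → Inv w a b → Inv w b c → ¬ IsPair k a b → ¬ IsPair k b c →
  Consecutive321 k w a b c
consecutive321 {n} d k w {a} {b} {c} bound σ∈w ab bc ¬ab ¬bc with Fin.any? (λ i →
  ((w ⟨$⟩ʳ suc i) Fin.<? (w ⟨$⟩ʳ inject₁ i)) ×-dec ¬? (protected? k w a b c i))
... | yes (i , desc , ¬protected) = shrink d bound
  where
  open Descent w i desc
  keep : ∀ {x y} → Inv w x y → ¬ (w ⟨$⟩ʳ suc i ≡ x × w ⟨$⟩ʳ inject₁ i ≡ y) → Inv (σ i ∘ₚ w) x y
  keep j ¬xy = [ (λ old → old) , (λ (x≡ , y≡) → contradiction (sym x≡ , sym y≡) ¬xy) ]′
                 (descent-⊑ j)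
  shrink : ∀ d → inv w ℕ.≤ d → Consecutive321 k w a b c
  shrink zero    bound =
    contradiction (ℕ.≤-trans (ℕ.≤-reflexive (sym (inv-descent w i desc))) bound) λ ()
  shrink (suc d) bound = record { Consecutive321 rec hiding (v⊑w)
                                ; v⊑w = λ x y → ⊑-descent x y ∘ Consecutive321.v⊑w rec x y }
    where
    rec : Consecutive321 k (σ i ∘ₚ w) a b c
    rec = consecutive321 d k (σ i ∘ₚ w)
      (ℕ.s≤s⁻¹ (ℕ.≤-trans (ℕ.≤-reflexive (sym (inv-descent w i desc))) bound))
      (keep σ∈w (¬protected ∘ inj₂ ∘ inj₂)) (keep ab (¬protected ∘ inj₁))
      (keep bc (¬protected ∘ inj₂ ∘ inj₁)) ¬ab ¬bc
... | no ¬step = record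
  { v = w ; v⊑w = λ _ _ i → i ; σ∈v = σ∈w ; a<b = ascending ab ; b<c = ascending bc
  ; i = proj₁ cb ; vi≡b = proj₁ (proj₂ cb) ; vi≡c = proj₂ (proj₂ cb)
  ; j = proj₁ ba ; vj≡a = proj₁ (proj₂ ba) ; vj≡b = proj₂ (proj₂ ba)
  }
  where
  only : ∀ i → w ⟨$⟩ʳ suc i < w ⟨$⟩ʳ inject₁ i → Protected k w a b c i
  only i desc = decidable-stable (protected? k w a b c i) λ ¬p → ¬step (i , desc , ¬p)
  at : ∀ {q x} → w ⟨$⟩ʳ q ≡ x → toℕ q ≡ toℕ (pos w x)
  at refl = cong toℕ (sym (inverseˡ w))
  cb : ∃ λ j → w ⟨$⟩ʳ suc j ≡ b × w ⟨$⟩ʳ inject₁ j ≡ c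
  cb = adjacent k w bc (λ j _ j<b desc → drop j j<b (only j desc)) ¬bc
    where
    -- The protected descent from `b` to `a` starts at the position of `b`, hence after this
    -- stretch.
    drop : ∀ j → suc j Fin.≤ pos w b → _ → _
    drop j j<b (inj₁ (_ , wj≡b)) =
      contradiction (ℕ.≤-trans (inject₁<suc j) j<b) (ℕ.<-irrefl (at wj≡b))
    drop j j<b (inj₂ rest) = rest
  ba : ∃ λ j → w ⟨$⟩ʳ suc j ≡ a × w ⟨$⟩ʳ inject₁ j ≡ b
  ba = adjacent k w ab (λ j b≤j _ desc → drop j b≤j (only j desc)) ¬ab
    where
    -- The protected descent from `c` to `b` ends at the position of `b`, hence before this stretch.
    drop : ∀ j → pos w b Fin.≤ inject₁ j → _ → _
    drop j b≤j (inj₁ adj) = inj₁ adj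
    drop j b≤j (inj₂ (inj₁ (wj≡b , _))) =
      contradiction (ℕ.≤-trans (inject₁<suc j) (ℕ.≤-trans (ℕ.≤-reflexive (at wj≡b)) b≤j))
                    (ℕ.<-irrefl refl)
    drop j b≤j (inj₂ (inj₂ p)) = inj₂ p

τ-fix : {i : Fin n} {x : Fin (suc n)} → x ≢ inject₁ i → x ≢ suc i → τ i x ≡ x
τ-fix {i = i} {x} x≢i x≢1+i with τ-view i x
... | low eq _     = contradiction eq x≢i
... | high eq _    = contradiction eq x≢1+i
... | other _ _ eq = eq

-- The hypotheses give `y ∧ z ≤ x` and `z ≤ x ∨ y`, so that `z ≤ (x ∨ y) ∧ z = x ∨ (y ∧ z) ≤ x`.
-- They are phrased through inversion sets because the lattice operations of the interval are
-- arbitrary.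
modular-law : {v w : Permutation′ (suc n)} → ModularInterval v w → (x y z : Interval v w) →
  proj₁ x ⊑ proj₁ z →
  (∀ a b → Inv (proj₁ y) a b → Inv (proj₁ z) a b → Inv (proj₁ x) a b) →
  (∀ u → proj₁ x ⊑ u → proj₁ y ⊑ u → proj₁ z ⊑ u) →
  proj₁ z ⊑ proj₁ x
modular-law (_∨_ , _∧_ , M) x y z x⊑z meet join a b i =
  ≤wk⇒⊑ (∨-least {x} {y ∧ z} {x} (⊑⇒≤wk λ _ _ i → i)
          (⊑⇒≤wk λ a b i → meet a b (≤wk⇒⊑ (x∧y≤x y z) a b i) (≤wk⇒⊑ (x∧y≤y y z) a b i)))
    a b (≈⇒⊑ (proj₁ ((x ∨ y) ∧ z)) (proj₁ (x ∨ (y ∧ z)))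
      (λ j → sym (modular x y z (⊑⇒≤wk x⊑z) j)) a b
      (≤wk⇒⊑ (∧-greatest {z} {x ∨ y} {z}
                (⊑⇒≤wk (join (proj₁ (x ∨ y)) (≤wk⇒⊑ (x≤x∨y x y)) (≤wk⇒⊑ (y≤x∨y x y))))
                (⊑⇒≤wk λ _ _ i → i)) a b i))
  where
  open IsModularLattice M
  open IsLattice isLattice

-- The interval from abc to cba is a hexagon; X = bac < Z = bca on one side and Y = acb
-- on the other violate the modular law.
module Hexagon (k : Fin n) (w : Permutation′ (suc n)) {a b c : Fin (suc n)}
               (¬ab : ¬ IsPair k a b) (¬bc : ¬ IsPair k b c) (cons : Consecutive321 k w a b c) where

  open Consecutive321 cons

  private
    a<c : a < c
    a<c = ℕ.<-trans a<b b<c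

    at-≢ : ∀ {p q x y} → v ⟨$⟩ʳ p ≡ x → v ⟨$⟩ʳ q ≡ y → x < y → p ≢ q
    at-≢ vp vq x<y refl = ℕ.<-irrefl (cong toℕ (trans (sym vp) vq)) x<y

    j≡1+i : inject₁ j ≡ suc i
    j≡1+i = trans (sym (inverseˡ v)) (trans (cong (pos v) (trans vj≡b (sym vi≡b))) (inverseˡ v))

    Z X Y′ Y : Permutation′ (suc n)
    Z  = σ i ∘ₚ v
    X  = σ j ∘ₚ Z
    Y′ = σ j ∘ₚ v
    Y  = σ i ∘ₚ Y′

    Zj≡c : Z ⟨$⟩ʳ inject₁ j ≡ c
    Zj≡c = trans (cong (v ⟨$⟩ʳ_)
      (trans (cong (σ i ⟨$⟩ʳ_) j≡1+i) (trans (σ≡τ i (suc i)) (τ-suc i)))) vi≡c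

    Zj≡a : Z ⟨$⟩ʳ suc j ≡ a
    Zj≡a = trans (cong (v ⟨$⟩ʳ_) (trans (σ≡τ i (suc j))
      (τ-fix (at-≢ vj≡a vi≡c a<c) (at-≢ vj≡a vi≡b a<b)))) vj≡a

    Y′i≡c : Y′ ⟨$⟩ʳ inject₁ i ≡ c
    Y′i≡c = trans (cong (v ⟨$⟩ʳ_) (trans (σ≡τ j (inject₁ i))
      (τ-fix (at-≢ vj≡b vi≡c b<c ∘ sym) (at-≢ vj≡a vi≡c a<c ∘ sym)))) vi≡c

    Y′i≡a : Y′ ⟨$⟩ʳ suc i ≡ a
    Y′i≡a = trans (cong (v ⟨$⟩ʳ_)
      (trans (cong (σ j ⟨$⟩ʳ_) (sym j≡1+i)) (trans (σ≡τ j (inject₁ j)) (τ-inject₁ j)))) vj≡a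

    module v→Z  = Descent v i (subst₂ _<_ (sym vi≡b) (sym vi≡c) b<c)
    module Z→X  = Descent Z j (subst₂ _<_ (sym Zj≡a) (sym Zj≡c) a<c)
    module v→Y′ = Descent v j (subst₂ _<_ (sym vj≡a) (sym vj≡b) a<b)
    module Y′→Y = Descent Y′ i (subst₂ _<_ (sym Y′i≡a) (sym Y′i≡c) a<c)

    v⊑Z : ∀ {x y} → Inv v x y → ¬ (x ≡ b × y ≡ c) → Inv Z x y
    v⊑Z xy ¬bc = [ (λ o → o) , (λ (x≡ , y≡) → contradiction (trans x≡ vi≡b , trans y≡ vi≡c) ¬bc) ]′
                   (v→Z.descent-⊑ xy)

    Z⊑X : ∀ {x y} → Inv Z x y → ¬ (x ≡ a × y ≡ c) → Inv X x y
    Z⊑X xy ¬ac = [ (λ o → o) , (λ (x≡ , y≡) → contradiction (trans x≡ Zj≡a , trans y≡ Zj≡c) ¬ac) ]′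
                   (Z→X.descent-⊑ xy)

    v⊑Y : ∀ {x y} → Inv v x y → ¬ (x ≡ a × y ≡ b) → ¬ (x ≡ a × y ≡ c) → Inv Y x y
    v⊑Y xy ¬ab ¬ac with v→Y′.descent-⊑ xy
    ... | inj₂ (x≡ , y≡) = contradiction (trans x≡ vj≡a , trans y≡ vj≡b) ¬ab
    ... | inj₁ xy′ with Y′→Y.descent-⊑ xy′
    ...   | inj₁ xy″       = xy″
    ...   | inj₂ (x≡ , y≡) = contradiction (trans x≡ Y′i≡a , trans y≡ Y′i≡c) ¬ac

    Y⊑v : Y ⊑ v
    Y⊑v x y = v→Y′.⊑-descent x y ∘ Y′→Y.⊑-descent x y

    ¬X-ac : ¬ Inv X a c
    ¬X-ac = subst₂ (λ x y → ¬ Inv X x y) Zj≡a Zj≡c Z→X.¬descent-new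

    ¬Y-ac : ¬ Inv Y a c
    ¬Y-ac = subst₂ (λ x y → ¬ Inv Y x y) Y′i≡a Y′i≡c Y′→Y.¬descent-new

    v-ab : Inv v a b
    v-ab = a<b , subst₂ _<_ (trans (sym (inverseˡ v)) (cong (pos v) vj≡b))
                            (trans (sym (inverseˡ v)) (cong (pos v) vj≡a)) (inject₁<suc j)

    v-bc : Inv v b c
    v-bc = b<c , subst₂ _<_ (trans (sym (inverseˡ v)) (cong (pos v) vi≡c))
                            (trans (sym (inverseˡ v)) (cong (pos v) vi≡b)) (inject₁<suc i)

    X-ab : Inv X a b
    X-ab = Z⊑X (v⊑Z v-ab (λ (a≡b , _) → Fin.<⇒≢ a<b a≡b)) (λ (_ , b≡c) → Fin.<⇒≢ b<c b≡c)

    Y-bc : Inv Y b c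
    Y-bc = v⊑Y v-bc (λ (b≡a , _) → Fin.<⇒≢ a<b (sym b≡a)) (λ (b≡a , _) → Fin.<⇒≢ a<b (sym b≡a))

    Z-ac : Inv Z a c
    Z-ac = v⊑Z (Inv-trans v v-ab v-bc) (λ (a≡b , _) → Fin.<⇒≢ a<b a≡b)

    -- `b` lies strictly between `a` and `c`, so these are not neighbouring letters.
    ¬ac : ¬ (inject₁ k ≡ a × suc k ≡ c)
    ¬ac (refl , refl) = between a<b b<c

    X⊑Z : X ⊑ Z
    X⊑Z = Z→X.⊑-descent

    Z⊑w : Z ⊑ w
    Z⊑w x y = v⊑w x y ∘ v→Z.⊑-descent x y

    X̂ Ŷ Ẑ : Interval (σ k) w
    X̂ = X , ⊑⇒≤wk (σ⊑ (Z⊑X (v⊑Z σ∈v (λ (p , q) → ¬bc (sym p , sym q))) ¬ac))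
          , ⊑⇒≤wk (λ x y → Z⊑w x y ∘ X⊑Z x y)
    Ŷ = Y , ⊑⇒≤wk (σ⊑ (v⊑Y σ∈v (λ (p , q) → ¬ab (sym p , sym q)) ¬ac))
          , ⊑⇒≤wk (λ x y → v⊑w x y ∘ Y⊑v x y)
    Ẑ = Z , ⊑⇒≤wk (σ⊑ (v⊑Z σ∈v (λ (p , q) → ¬bc (sym p , sym q)))) , ⊑⇒≤wk Z⊑w

  ¬modular : ¬ ModularInterval (σ k) w
  ¬modular M = ¬X-ac (modular-law M X̂ Ŷ Ẑ X⊑Z meet join a c Z-ac)
    where
    -- The only inversion of `Z` outside `X` is `(a , c)`, and `Y` lacks it as well.
    meet : ∀ x y → Inv Y x y → Inv Z x y → Inv X x y
    meet x y i j = Z⊑X j λ { (refl , refl) → ¬Y-ac i }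
    -- Above both, `(a , c)` is forced by transitivity: `(a , b)` comes from `X` and `(b , c)` from
    -- `Y`.
    join : ∀ u → X ⊑ u → Y ⊑ u → Z ⊑ u
    join u X⊑u Y⊑u x y i with (x Fin.≟ a) ×-dec (y Fin.≟ c)
    ... | yes (refl , refl) = Inv-trans u (X⊑u a b X-ab) (Y⊑u b c Y-bc)
    ... | no ¬ac            = X⊑u x y (Z⊑X i ¬ac)

modular⇒no321 : (k : Fin n) (w : Permutation′ (suc n)) → σ k ≤wk w → ModularInterval (σ k) w →
                NoOther321 k w
modular⇒no321 k w σk≤w M {a} {b} {c} ab bc with isPair? k a b | isPair? k b c
... | yes p | _     = inj₁ p
... | _     | yes p = inj₂ p
... | no ¬p | no ¬q = contradiction M (Hexagon.¬modular k w ¬p ¬q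
  (consecutive321 (inv w) k w ℕ.≤-refl (≤wk⇒⊑ σk≤w _ _ (Inv-σ k)) ab bc ¬p ¬q))

-- One inequality holds in any lattice once `x ≤ z`; for the other, `z` is distributed over `x ∨ y`
-- and `z ∧ x ≤ x` is applied.
distributive⇒modular : {v w : Permutation′ (suc n)} → DistributiveInterval v w → ModularInterval v w
distributive⇒modular (_∨_ , _∧_ , D) = _∨_ , _∧_ , record
  { isLattice = isLattice
  ; modular   = λ x y z x≤z →
      antisym {x ∨ (y ∧ z)} {(x ∨ y) ∧ z}
        (∨-least {x} {y ∧ z} {(x ∨ y) ∧ z}
          (∧-greatest {x} {x ∨ y} {z} (x≤x∨y x y) x≤z)
          (∧-greatest {y ∧ z} {x ∨ y} {z}
            (trans′ {y ∧ z} {y} {x ∨ y} (x∧y≤x y z) (y≤x∨y x y)) (x∧y≤y y z)))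
        (trans′ {(x ∨ y) ∧ z} {(z ∧ x) ∨ (z ∧ y)} {x ∨ (y ∧ z)}
          (trans′ {(x ∨ y) ∧ z} {z ∧ (x ∨ y)} {(z ∧ x) ∨ (z ∧ y)}
            (∧-greatest {(x ∨ y) ∧ z} {z} {x ∨ y} (x∧y≤y (x ∨ y) z) (x∧y≤x (x ∨ y) z))
            (reflexive {z ∧ (x ∨ y)} {(z ∧ x) ∨ (z ∧ y)} (∧-distribˡ-∨ z x y)))
          (∨-least {z ∧ x} {z ∧ y} {x ∨ (y ∧ z)}
            (trans′ {z ∧ x} {x} {x ∨ (y ∧ z)} (x∧y≤y z x) (x≤x∨y x (y ∧ z)))
            (trans′ {z ∧ y} {y ∧ z} {x ∨ (y ∧ z)}
              (∧-greatest {z ∧ y} {y} {z} (x∧y≤y z y) (x∧y≤x z y)) (y≤x∨y x (y ∧ z)))))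
  }
  where open IsDistributiveLattice D renaming (trans to trans′)

-- Insertion codes

infixr 5 _∷_

-- The head is the position at which the smallest letter is inserted; the tail encodes the remaining
-- letters, lowered by one.
data Code : ℕ → Set where
  []  : Code zero
  _∷_ : Fin (suc n) → Code n → Code (suc n)

decode : Code n → Permutation′ n
decode []      = id
decode (i ∷ c) = insert i zero (decode c)

encode : Permutation′ n → Code n
encode {zero}  w = []
encode {suc n} w = pos w zero ∷ encode (remove (pos w zero) w)

decode-encode : (w : Permutation′ n) → decode (encode w) ≈ w
decode-encode w = pos-cong⁻¹ (decode (encode w)) w (positions w)
  where
  positions : (w : Permutation′ n) → ∀ a → pos (decode (encode w)) a ≡ pos w a
  positions {suc n} w zero    = refl
  positions {suc n} w (suc a) = begin
    punchIn i (pos (decode (encode (remove i w))) a) ≡⟨ cong (punchIn i) (positions (remove i w) a) ⟩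
    punchIn i (pos (remove i w) a)                   ≡⟨ Fin.punchIn-punchOut _ ⟩
    pos w (punchIn (w ⟨$⟩ʳ i) a)                     ≡⟨ cong (λ b → pos w (punchIn b a)) (inverseʳ w) ⟩
    pos w (suc a)                                    ∎
    where
    open ≡-Reasoning
    i : Fin (suc n)
    i = pos w zero

decode-injective : (c d : Code n) → decode c ≈ decode d → c ≡ d
decode-injective c d eq = go c d (pos-cong (decode c) (decode d) eq)
  where
  go : (c d : Code n) → (∀ a → pos (decode c) a ≡ pos (decode d) a) → c ≡ d
  go []      []      eq = refl
  go (i ∷ c) (j ∷ d) eq with refl ← eq zero =
    cong (i ∷_) (go c d (Fin.punchIn-injective i _ _ ∘ eq ∘ suc))

punchIn-mono-< : ∀ (i : Fin (suc n)) {j k : Fin n} → j < k → punchIn i j < punchIn i k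
punchIn-mono-< i j<k = ℕ.≰⇒> (ℕ.<⇒≱ j<k ∘ Fin.punchIn-cancel-≤ i _ _)

punchIn-cancel-< : ∀ (i : Fin (suc n)) {j k : Fin n} → punchIn i j < punchIn i k → j < k
punchIn-cancel-< i j<k = ℕ.≰⇒> (ℕ.<⇒≱ j<k ∘ Fin.punchIn-mono-≤ i _ _)

≤-punchIn : ∀ (i : Fin (suc n)) (j : Fin n) → toℕ j ℕ.≤ toℕ (punchIn i j)
≤-punchIn zero    j       = ℕ.n≤1+n _
≤-punchIn (suc i) zero    = z≤n
≤-punchIn (suc i) (suc j) = s≤s (≤-punchIn i j)

punchIn<⁺ : ∀ (i : Fin (suc n)) (j : Fin n) → toℕ j ℕ.< toℕ i → punchIn i j < i
punchIn<⁺ (suc i) zero    _         = s≤s z≤n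
punchIn<⁺ (suc i) (suc j) (s≤s j<i) = s≤s (punchIn<⁺ i j j<i)

punchIn<⁻ : ∀ (i : Fin (suc n)) (j : Fin n) → punchIn i j < i → toℕ j ℕ.< toℕ i
punchIn<⁻ i j = ℕ.≤-<-trans (≤-punchIn i j)

Inv-suc⁺ : (i : Fin (suc n)) (c : Code n) {a b : Fin n} →
           Inv (decode c) a b → Inv (decode (i ∷ c)) (suc a) (suc b)
Inv-suc⁺ i c (a<b , b⇠a) = s≤s a<b , punchIn-mono-< i b⇠a

Inv-suc⁻ : (i : Fin (suc n)) (c : Code n) {a b : Fin n} →
           Inv (decode (i ∷ c)) (suc a) (suc b) → Inv (decode c) a b
Inv-suc⁻ i c (s≤s a<b , b⇠a) = a<b , punchIn-cancel-< i b⇠a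

-- Inserting a new smallest value at position i into a permutation starting with an
-- increasing run of length L ≥ i makes the initial run have length `run L i`.
run : ℕ → ℕ → ℕ
run L zero    = suc L
run L (suc i) = suc i

initialRun : Code n → ℕ
initialRun []      = 0
initialRun (i ∷ c) = run (initialRun c) (toℕ i)

Allowed : Code n → Set
Allowed []      = ⊤
Allowed (i ∷ c) = Allowed c × toℕ i ℕ.≤ initialRun c

initialRun≤ : (c : Code n) → initialRun c ℕ.≤ n
initialRun≤ []          = z≤n
initialRun≤ (zero ∷ c)  = s≤s (initialRun≤ c)
initialRun≤ (suc i ∷ c) = ℕ.m≤n⇒m≤1+n (Fin.toℕ<n i)

-- No entry in the first `i` positions has a larger one before it, which says that these entries
-- increase.
IncreasingUpTo : Permutation′ n → ℕ → Set
IncreasingUpTo w i = ∀ {a b} → Inv w a b → i ℕ.≤ toℕ (pos w a)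

-- Insertion never moves a letter to the left, so inversions of the tail stay outside the run; the
-- inserted letter ends the run before it unless it stands in front.
≤initialRun⇒increasing : (c : Code n) → Allowed c → ∀ {i} → i ℕ.≤ initialRun c →
                         IncreasingUpTo (decode c) i
≤initialRun⇒increasing (j ∷ c) _ i≤ {zero} {zero} (() , _)
≤initialRun⇒increasing (suc j ∷ c) _ i≤ {zero} {suc b} ab = i≤
≤initialRun⇒increasing (zero ∷ c) (ok , _) {zero} i≤ {suc a} {suc b} ab = z≤n
≤initialRun⇒increasing (zero ∷ c) (ok , _) {suc i} (s≤s i≤) {suc a} {suc b} ab =
  s≤s (≤initialRun⇒increasing c ok i≤ (Inv-suc⁻ zero c ab))
≤initialRun⇒increasing (suc j ∷ c) (ok , j≤) i≤ {suc a} {suc b} ab =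
  ℕ.≤-trans (≤initialRun⇒increasing c ok (ℕ.≤-trans i≤ j≤) (Inv-suc⁻ (suc j) c ab))
            (≤-punchIn (suc j) _)

increasing⇒≤initialRun : (c : Code n) → ∀ {i} → i ℕ.≤ n → IncreasingUpTo (decode c) i →
                         i ℕ.≤ initialRun c
increasing⇒≤initialRun []         i≤n inc = i≤n
increasing⇒≤initialRun (zero ∷ c) {zero}  i≤n inc = z≤n
increasing⇒≤initialRun (zero ∷ c) {suc i} (s≤s i≤n) inc =
  s≤s (increasing⇒≤initialRun c i≤n λ ab → ℕ.s≤s⁻¹ (inc (Inv-suc⁺ zero c ab)))
-- The first entry and the smallest letter, which stands at position `suc j`, form an inversion; it
-- bounds `i` by `suc j`.
increasing⇒≤initialRun {suc n} (suc j ∷ c) i≤n inc = inc (0<first , pos<)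
  where
  w : Permutation′ (suc n)
  w = decode (suc j ∷ c)
  first : Fin (suc n)
  first = w ⟨$⟩ʳ zero
  pos< : pos w first < suc j
  pos< = subst (_< suc j) (sym (inverseˡ w)) (s≤s z≤n)
  0<first : zero {n} < first
  0<first with <-cmp zero first
  ... | tri< 0<x _ _ = 0<x
  ... | tri≈ _ 0≡x _ =
    contradiction (subst (λ x → pos w x < suc j) (sym 0≡x) pos<) (ℕ.<-irrefl refl)

Avoids321 : Permutation′ n → Set
Avoids321 w = ∀ {a b c} → Inv w a b → ¬ Inv w b c

-- A 321-pattern not already in the tail ends in the inserted letter, so its other two letters would
-- form an inversion within the increasing part in front of it.
allowed⇒avoids : (c : Code n) → Allowed c → Avoids321 (decode c)
allowed⇒avoids (i ∷ c) (ok , i≤) {suc a} {suc b} {suc d} ab bd =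
  allowed⇒avoids c ok (Inv-suc⁻ i c ab) (Inv-suc⁻ i c bd)
allowed⇒avoids (i ∷ c) (ok , i≤) {zero} {suc b} {suc d} (_ , b⇠0) bd =
  ℕ.<⇒≱ (punchIn<⁻ i _ b⇠0) (≤initialRun⇒increasing c ok i≤ (Inv-suc⁻ i c bd))
allowed⇒avoids (i ∷ c) _ {_} {zero} (() , _) _
allowed⇒avoids (i ∷ c) _ {_} {_} {zero} _ (() , _)

avoids⇒allowed : (c : Code n) → Avoids321 (decode c) → Allowed c
avoids⇒allowed []      _     = tt
avoids⇒allowed (i ∷ c) avoid =
  avoids⇒allowed c (λ ab bd → avoid (Inv-suc⁺ i c ab) (Inv-suc⁺ i c bd)) ,
  increasing⇒≤initialRun c (ℕ.s≤s⁻¹ (Fin.toℕ<n i)) λ ab →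
    ℕ.≮⇒≥ λ pos<i → avoid {zero} (s≤s z≤n , punchIn<⁺ i _ pos<i) (Inv-suc⁺ i c ab)

-- For `k = 0` the two letters are inserted last: the smaller one, inserted at `i ≤ j`, pushes the
-- other to its right. Inserting still smaller letters keeps their order.
Ordered : Fin n → Code (suc n) → Set
Ordered zero    (i ∷ j ∷ c) = toℕ i ℕ.≤ toℕ j
Ordered (suc k) (i ∷ c)     = Ordered k c

ordered⇒ : (k : Fin n) (c : Code (suc n)) → Ordered k c → ¬ Inv (decode c) (inject₁ k) (suc k)
ordered⇒ zero    (i ∷ j ∷ c) i≤j (_ , rev) = ℕ.<⇒≱ (punchIn<⁻ i j rev) i≤j
ordered⇒ (suc k) (i ∷ c)     ord inv       = ordered⇒ k c ord (Inv-suc⁻ i c inv)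

⇒ordered : (k : Fin n) (c : Code (suc n)) → ¬ Inv (decode c) (inject₁ k) (suc k) → Ordered k c
⇒ordered zero    (i ∷ j ∷ c) ¬inv = ℕ.≮⇒≥ λ j<i → ¬inv (s≤s z≤n , punchIn<⁺ i j j<i)
⇒ordered (suc k) (i ∷ c)     ¬inv = ⇒ordered k c (¬inv ∘ Inv-suc⁺ i c)

-- Exchanging the letters `k` and `k + 1`

module Translate (k : Fin n) (w : Permutation′ (suc n)) where

  private
    u : Permutation′ (suc n)
    u = w ∘ₚ σ k

    ¬IsPair-τ : ∀ {a b} → a < b → ¬ IsPair k (τ k a) (τ k b)
    ¬IsPair-τ {a} {b} a<b (p , q) = ℕ.<-asym (inject₁<suc k) (subst₂ _<_
      (trans (sym (τ-involutive k a)) (trans (cong (τ k) p) (τ-inject₁ k)))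
      (trans (sym (τ-involutive k b)) (trans (cong (τ k) q) (τ-suc k))) a<b)

    Inv-τ : ∀ {a b} → ¬ IsPair k a b → Inv u a b → Inv w (τ k a) (τ k b)
    Inv-τ ¬pair (a<b , rev) = τ-mono-< k a<b ¬pair , rev

    Inv-τ′ : ∀ {a b} → ¬ IsPair k a b → Inv w a b → Inv u (τ k a) (τ k b)
    Inv-τ′ {a} {b} ¬pair (a<b , rev) = τ-mono-< k a<b ¬pair ,
      subst₂ (λ x y → pos w x < pos w y) (sym (τ-involutive k b)) (sym (τ-involutive k a)) rev

    pos-u-low : pos u (inject₁ k) ≡ pos w (suc k)
    pos-u-low = cong (pos w) (τ-inject₁ k)

    pos-u-high : pos u (suc k) ≡ pos w (inject₁ k)
    pos-u-high = cong (pos w) (τ-suc k)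

  -- Relabelling a 321-pattern of `u` by `τ k` gives one of `w`. It would have to involve the pair
  -- of `σ k`, but only a descending pair is sent there by `τ k`.
  avoids : Inv w (inject₁ k) (suc k) → NoOther321 k w →
           Avoids321 u × ¬ Inv u (inject₁ k) (suc k)
  avoids (_ , rev) no321 = (λ ab bc →
      [ ¬IsPair-τ (ascending ab) , ¬IsPair-τ (ascending bc) ]′
      (no321 (Inv-τ (¬pair ab) ab) (Inv-τ (¬pair bc) bc))) , ¬inv
    where
    ¬inv : ¬ Inv u (inject₁ k) (suc k)
    ¬inv (_ , rev′) = ℕ.<-asym rev (subst₂ _<_ pos-u-high pos-u-low rev′)
    ¬pair : ∀ {a b} → Inv u a b → ¬ IsPair k a b
    ¬pair inv (refl , refl) = ¬inv inv

  noOther321 : Avoids321 u → NoOther321 k w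
  noOther321 avoid {a} {b} {c} ab bc with isPair? k a b | isPair? k b c
  ... | yes p | _     = inj₁ p
  ... | _     | yes p = inj₂ p
  ... | no ¬p | no ¬q = contradiction (Inv-τ′ ¬q bc) (avoid (Inv-τ′ ¬p ab))

  pair-inverted : ¬ Inv u (inject₁ k) (suc k) → Inv w (inject₁ k) (suc k)
  pair-inverted ¬inv = inject₁<suc k ,
    subst₂ _<_ pos-u-low pos-u-high (¬Inv-pos u (inject₁<suc k) ¬inv)

-- Weighted counting of codes

indicator-× : (P? : Dec P) (Q? : Dec Q) → indicator (P? ×-dec Q?) ≡ indicator P? * indicator Q?
indicator-× (yes _) Q? = sym (ℕ.+-identityʳ _)
indicator-× (no _)  Q? = refl

sumBelow : ℕ → (ℕ → ℕ) → ℕ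
sumBelow m h = sum {m} (h ∘ toℕ)

sumBelow-cong : ∀ m {f g : ℕ → ℕ} → (∀ i → f i ≡ g i) → sumBelow m f ≡ sumBelow m g
sumBelow-cong m eq = sum-cong-≗ {m} (eq ∘ toℕ)

sumBelow-last : ∀ m (h : ℕ → ℕ) → sumBelow (suc m) h ≡ sumBelow m h + h m
sumBelow-last zero    h = ℕ.+-identityʳ _
sumBelow-last (suc m) h = trans (cong (h 0 +_) (sumBelow-last m (h ∘ suc)))
  (sym (ℕ.+-assoc (h 0) _ _))

sum-truncate : ∀ {n} L → L ℕ.≤ n → (h : ℕ → ℕ) →
  sum {suc n} (λ i → indicator (toℕ i ℕ.≤? L) * h (toℕ i)) ≡ sumBelow (suc L) h
sum-truncate {n} zero L≤n h =
  cong₂ _+_ (ℕ.+-identityʳ (h 0)) (sum-zero {n} λ i → refl)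
sum-truncate {suc n} (suc L) (s≤s L≤n) h = cong₂ _+_ (ℕ.+-identityʳ (h 0))
  (trans (sum-cong-≗ {suc n} {λ i → indicator (suc (toℕ i) ℕ.≤? suc L) * h (suc (toℕ i))} λ i →
           cong (_* h (suc (toℕ i)))
             (indicator-cong (suc (toℕ i) ℕ.≤? suc L) (toℕ i ℕ.≤? L) ℕ.s≤s⁻¹ s≤s))
         (sum-truncate L L≤n (h ∘ suc)))

sum-allowed : ∀ {n} β L → L ℕ.≤ n → (h : ℕ → ℕ) →
  sum {suc n} (λ i → (β * indicator (toℕ i ℕ.≤? L)) * h (toℕ i)) ≡ β * sumBelow (suc L) h
sum-allowed {n} β L L≤n h = begin
  sum {suc n} (λ i → (β * indicator (toℕ i ℕ.≤? L)) * h (toℕ i))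
    ≡⟨ sum-cong-≗ {suc n} (λ i → ℕ.*-assoc β (indicator (toℕ i ℕ.≤? L)) (h (toℕ i))) ⟩
  sum {suc n} (λ i → β * (indicator (toℕ i ℕ.≤? L) * h (toℕ i)))
    ≡⟨ *-distribˡ-sum {suc n} β (λ i → indicator (toℕ i ℕ.≤? L) * h (toℕ i)) ⟨
  β * sum {suc n} (λ i → indicator (toℕ i ℕ.≤? L) * h (toℕ i))
    ≡⟨ cong (β *_) (sum-truncate L L≤n h) ⟩
  β * sumBelow (suc L) h ∎
  where open ≡-Reasoning

total : (Code n → ℕ) → ℕ
total {zero}  F = F []
total {suc n} F = total λ c → sum λ i → F (i ∷ c)

total-cong : {F G : Code n → ℕ} → (∀ c → F c ≡ G c) → total F ≡ total G
total-cong {zero}  eq = eq []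
total-cong {suc n} eq = total-cong λ c → sum-cong-≗ λ i → eq (i ∷ c)

total-+ : (F G : Code n → ℕ) → total (λ c → F c + G c) ≡ total F + total G
total-+ {zero}  F G = refl
total-+ {suc n} F G = trans (total-cong λ c → ∑-distrib-+ (λ i → F (i ∷ c)) (λ i → G (i ∷ c)))
  (total-+ (λ c → sum λ i → F (i ∷ c)) (λ c → sum λ i → G (i ∷ c)))

allowed? : (c : Code n) → Dec (Allowed c)
allowed? []      = yes tt
allowed? (i ∷ c) = allowed? c ×-dec (toℕ i ℕ.≤? initialRun c)

ordered? : (k : Fin n) (c : Code (suc n)) → Dec (Ordered k c)
ordered? zero    (i ∷ j ∷ c) = toℕ i ℕ.≤? toℕ j
ordered? (suc k) (i ∷ c)     = ordered? k c

-- The transfer operator of insertion: the total weight of the results of the `L + 1` allowed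
-- insertions into a permutation with initial run `L`.
extend : (ℕ → ℕ) → ℕ → ℕ
extend f L = sumBelow (suc L) (f ∘ run L)

allowedWeight : (n : ℕ) → (ℕ → ℕ) → ℕ
allowedWeight n f = total {n} λ c → indicator (allowed? c) * f (initialRun c)

disorderedWeight : Fin n → (ℕ → ℕ) → ℕ
disorderedWeight k f = total λ c →
  indicator (allowed? c) * (indicator (¬? (ordered? k c)) * f (initialRun c))

allowedWeight-suc : ∀ n f → allowedWeight (suc n) f ≡ allowedWeight n (extend f)
allowedWeight-suc n f = total-cong {n} λ c → trans
  (sum-cong-≗ {suc n} λ i → cong (_* f (run (initialRun c) (toℕ i)))
    (indicator-× (allowed? c) (toℕ i ℕ.≤? initialRun c)))
  (sum-allowed (indicator (allowed? c)) (initialRun c) (initialRun≤ c) (f ∘ run (initialRun c)))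

-- An allowed code i ∷ j ∷ c with i > j has j = 0, and then i ranges over 1, …, initialRun c + 1.
disordered-pair : ∀ (f : ℕ → ℕ) L →
  sumBelow (suc L) (λ j → sumBelow (suc (run L j)) λ i →
    indicator (¬? (i ℕ.≤? j)) * f (run (run L j) i)) ≡ extend f L
disordered-pair f L = begin
  sumBelow (suc L) (λ i → 1 * f (suc i)) + sumBelow L (λ j → sumBelow (suc (suc j)) (term j))
    ≡⟨ cong₂ _+_ (sumBelow-cong (suc L) λ i → ℕ.+-identityʳ (f (suc i)))
         (sum-zero {L} λ j → sum-zero {suc (suc (toℕ j))} λ i → vanish (toℕ j) i) ⟩
  sumBelow (suc L) (f ∘ suc) + 0
    ≡⟨ ℕ.+-identityʳ _ ⟩
  sumBelow (suc L) (f ∘ suc)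
    ≡⟨ sumBelow-last L (f ∘ suc) ⟩
  sumBelow L (f ∘ suc) + f (suc L)
    ≡⟨ ℕ.+-comm (sumBelow L (f ∘ suc)) _ ⟩
  extend f L ∎
  where
  open ≡-Reasoning
  term : ℕ → ℕ → ℕ
  term j i = indicator (¬? (i ℕ.≤? suc j)) * f (run (suc j) i)
  -- After an insertion at `suc j` the run has length `suc j`, so no allowed `i` exceeds it.
  vanish : ∀ j (i : Fin (suc (suc j))) → term j (toℕ i) ≡ 0
  vanish j i = cong (_* f (run (suc j) (toℕ i)))
    (indicator-no (¬? (toℕ i ℕ.≤? suc j)) λ i≰ → i≰ (ℕ.s≤s⁻¹ (Fin.toℕ<n i)))

-- Stripping the head turns `f` into `extend f` on both sides, which is why the weight is arbitrary.
-- For `k = 0`, `disordered-pair` shows that the last two insertions together weigh as much as a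
-- single unrestricted one.
disorderedWeight≡ : (k : Fin n) (f : ℕ → ℕ) → disorderedWeight k f ≡ allowedWeight n f
disorderedWeight≡ {suc n} (suc k) f = begin
  disorderedWeight (suc k) f
    ≡⟨ total-cong {suc n} (λ c → trans
         (sum-cong-≗ {suc (suc n)} λ i → cong (_* (δ c * f (run (initialRun c) (toℕ i))))
           (indicator-× (allowed? c) (toℕ i ℕ.≤? initialRun c)))
         (trans (sum-allowed (indicator (allowed? c)) (initialRun c) (initialRun≤ c)
                  (λ i → δ c * f (run (initialRun c) i)))
           (cong (indicator (allowed? c) *_)
             (sym (*-distribˡ-sum {suc (initialRun c)} (δ c) (f ∘ run (initialRun c) ∘ toℕ)))))) ⟩
  disorderedWeight k (extend f)
    ≡⟨ disorderedWeight≡ k (extend f) ⟩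
  allowedWeight n (extend f)
    ≡⟨ allowedWeight-suc n f ⟨
  allowedWeight (suc n) f ∎
  where
  open ≡-Reasoning
  δ : Code (suc n) → ℕ
  δ c = indicator (¬? (ordered? k c))
disorderedWeight≡ {suc n} zero f = begin
  disorderedWeight (zero {n}) f
    ≡⟨ total-cong {n} (λ c → trans
         (sum-cong-≗ {suc n} λ j → trans
           (sum-cong-≗ {suc (suc n)} λ i →
             cong (_* (indicator (¬? (toℕ i ℕ.≤? toℕ j)) * f (run (initialRun (j ∷ c)) (toℕ i))))
             (indicator-× (allowed? (j ∷ c)) (toℕ i ℕ.≤? initialRun (j ∷ c))))
           (trans (sum-allowed
               (indicator (allowed? (j ∷ c))) (initialRun (j ∷ c)) (initialRun≤ (j ∷ c))
               (λ i → indicator (¬? (i ℕ.≤? toℕ j)) * f (run (initialRun (j ∷ c)) i)))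
             (cong (_* inner c (toℕ j)) (indicator-× (allowed? c) (toℕ j ℕ.≤? initialRun c)))))
         (trans (sum-allowed (indicator (allowed? c)) (initialRun c) (initialRun≤ c) (inner c))
           (cong (indicator (allowed? c) *_) (disordered-pair f (initialRun c))))) ⟩
  allowedWeight n (extend f)
    ≡⟨ allowedWeight-suc n f ⟨
  allowedWeight (suc n) f ∎
  where
  open ≡-Reasoning
  inner : Code n → ℕ → ℕ
  inner c j = sumBelow (suc (run (initialRun c) j)) λ i →
    indicator (¬? (i ℕ.≤? j)) * f (run (run (initialRun c) j) i)

-- Ballot numbers

-- The number of ways to make `n` further allowed insertions from an initial run of length `L`.
ballot : ℕ → ℕ → ℕ
ballot zero    L = 1
ballot (suc n) L = extend (ballot n) L

-- Each step moves one insertion from the code into the weight, until the empty code with run 0 is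
-- left.
allowedWeight-ballot : ∀ n m → allowedWeight n (ballot m) ≡ ballot (n + m) 0
allowedWeight-ballot zero    m = ℕ.+-identityʳ _
allowedWeight-ballot (suc n) m = trans (allowedWeight-suc n (ballot m))
  (trans (allowedWeight-ballot n (suc m)) (cong (λ x → ballot x 0) (ℕ.+-suc n m)))

-- Insertions behind the front of a run of length `L + 1` produce runs 1, ..., `L + 1`, exactly
-- those produced by all insertions into a run of length `L`.
ballot-suc : ∀ n L → ballot (suc n) (suc L) ≡ ballot n (suc (suc L)) + ballot (suc n) L
ballot-suc n L = cong (ballot n (suc (suc L)) +_)
  (trans (sumBelow-last L (ballot n ∘ suc)) (ℕ.+-comm (sumBelow L (ballot n ∘ suc)) _))

-- The reflection principle, with both sides moved so that no subtraction occurs.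
ballot-C : ∀ n L → ballot (suc n) L + (suc n + suc n + L) C n ≡ (suc n + suc n + L) C suc n
ballot-C n L = go n L (suc n + suc n + L) refl
  where
  pascal : ∀ N k → suc N C suc k ≡ N C k + N C suc k
  pascal N k = sym (nCk+nC[k+1]≡[n+1]C[k+1] N k)
  open ≡-Reasoning
  go : ∀ n L N → suc n + suc n + L ≡ N → ballot (suc n) L + N C n ≡ N C suc n
  go zero L N refl = trans (cong (_+ 1) (ones L)) (trans (ℕ.+-comm _ 1) (sym (nC1≡n (2 + L))))
    where
    ones : ∀ L → ballot 1 L ≡ suc L
    ones L = cong suc (sum-one L)
  go (suc n) zero (suc N) eq = begin
    (ballot (suc n) 1 + 0) + suc N C suc n ≡⟨ cong₂ _+_ (ℕ.+-identityʳ _) (pascal N n) ⟩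
    ballot (suc n) 1 + (N C n + N C suc n) ≡⟨ ℕ.+-assoc (ballot (suc n) 1) _ _ ⟨
    (ballot (suc n) 1 + N C n) + N C suc n ≡⟨ cong (_+ N C suc n) (go n 1 N N≡) ⟩
    N C suc n + N C suc n                  ≡⟨ cong (N C suc n +_) symmetric ⟩
    N C suc n + N C suc (suc n)            ≡⟨ pascal N (suc n) ⟨
    suc N C suc (suc n)                    ∎
    where
    N≡ : suc n + suc n + 1 ≡ N
    N≡ = trans (shift n) (ℕ.suc-injective eq)
      where
      shift : ∀ n → suc n + suc n + 1 ≡ suc n + suc (suc n) + 0
      shift = solve-∀
    N≡′ : suc n + suc (suc n) ≡ N
    N≡′ = trans (sym (ℕ.+-identityʳ _)) (ℕ.suc-injective eq)
    -- `N` is the odd number `2 n + 3`, and the two middle entries of its row coincide.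
    symmetric : N C suc n ≡ N C suc (suc n)
    symmetric = subst (λ N → N C suc n ≡ N C suc (suc n)) N≡′
      (trans (nCk≡nC[n∸k] (ℕ.m≤m+n (suc n) (suc (suc n))))
        (cong ((suc n + suc (suc n)) C_) (ℕ.m+n∸m≡n (suc n) (suc (suc n)))))
  go (suc n) (suc L) (suc N) eq = begin
    ballot (2 + n) (suc L) + suc N C suc n
      ≡⟨ cong₂ _+_ (ballot-suc (suc n) L) (pascal N n) ⟩
    (ballot (suc n) (2 + L) + ballot (2 + n) L) + (N C n + N C suc n)
      ≡⟨ rearrange (ballot (suc n) (2 + L)) (ballot (2 + n) L) (N C n) (N C suc n) ⟩
    (ballot (suc n) (2 + L) + N C n) + (ballot (2 + n) L + N C suc n)
      ≡⟨ cong₂ _+_ (go n (2 + L) N (trans (shift n L) (ℕ.suc-injective eq)))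
                    (go (suc n) L N (trans (sym (ℕ.+-suc _ L)) (ℕ.suc-injective eq))) ⟩
    N C suc n + N C suc (suc n)
      ≡⟨ pascal N (suc n) ⟨
    suc N C suc (suc n) ∎
    where
    shift : ∀ n L → suc n + suc n + (2 + L) ≡ suc n + suc (suc n) + suc L
    shift = solve-∀
    rearrange : ∀ a b c d → (a + b) + (c + d) ≡ (a + c) + (b + d)
    rearrange = solve-∀

-- The rule `(k + 1) C(n, k + 1) = (n - k) C(n, k)` with the subtraction moved across, by induction
-- through Pascal's rule.
absorption : ∀ n k → suc k * (n C suc k) + k * (n C k) ≡ n * (n C k)
absorption zero zero    = refl
absorption zero (suc k) = cong₂ _+_ (zeros (suc (suc k)) (suc k)) (zeros (suc k) k)
  where
  zeros : ∀ m k → m * (0 C suc k) ≡ 0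
  zeros m k = trans (cong (m *_) (k>n⇒nCk≡0 {0} {suc k} (s≤s z≤n))) (ℕ.*-zeroʳ m)
absorption (suc n) zero = trans (ℕ.+-identityʳ _) (trans (ℕ.*-identityˡ _)
  (trans (nC1≡n (suc n)) (sym (ℕ.*-identityʳ (suc n)))))
absorption (suc n) (suc k) = begin
  (2 + k) * (suc n C (2 + k)) + suc k * (suc n C suc k)
    ≡⟨ cong₂ (λ a b → (2 + k) * a + suc k * b) (pascal (suc k)) (pascal k) ⟩
  (2 + k) * (y + z) + suc k * (x + y)
    ≡⟨ expand k x y z ⟩
  ((2 + k) * z + suc k * y) + (suc k * y + k * x) + x + y
    ≡⟨ cong₂ (λ a b → a + b + x + y) (absorption n (suc k)) (absorption n k) ⟩
  n * y + n * x + x + y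
    ≡⟨ collect n x y ⟩
  suc n * (x + y)
    ≡⟨ cong (suc n *_) (pascal k) ⟨
  suc n * (suc n C suc k) ∎
  where
  open ≡-Reasoning
  x y z : ℕ
  x = n C k
  y = n C suc k
  z = n C suc (suc k)
  pascal : ∀ k → suc n C suc k ≡ n C k + n C suc k
  pascal k = sym (nCk+nC[k+1]≡[n+1]C[k+1] n k)
  expand : ∀ k x y z → (2 + k) * (y + z) + suc k * (x + y) ≡
                       ((2 + k) * z + suc k * y) + (suc k * y + k * x) + x + y
  expand = solve-∀
  collect : ∀ n x y → n * y + n * x + x + y ≡ suc n * (x + y)
  collect = solve-∀

-- For `m = n + 1` the reflection principle gives `b = y - x`, and absorption gives
-- `m y = (m + 1) x`; hence `b (m + 1) = y`. Adding `m * y + n * x` to both sides keeps the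
-- computation in the natural numbers.
catalan≡ballot : ∀ n → catalan n ≡ ballot n 0
catalan≡ballot zero    = refl
catalan≡ballot (suc n) = begin
  y / suc m           ≡⟨ cong (_/ suc m) y≡ ⟩
  (b * suc m) / suc m ≡⟨ m*n/n≡m b (suc m) ⟩
  b                   ∎
  where
  open ≡-Reasoning
  m b x y : ℕ
  m = suc n
  b = ballot m 0
  x = (2 * m) C n
  y = (2 * m) C m
  b+x≡y : b + x ≡ y
  b+x≡y = subst (λ N → b + N C n ≡ N C m)
    (ℕ.+-assoc m m 0) (ballot-C n 0)
  my≡ : m * y + n * x ≡ (2 * m) * x
  my≡ = absorption (2 * m) n
  regroup : ∀ n b x → (b + x) + (suc n * (b + x) + n * x) ≡ b * suc (suc n) + 2 * suc n * x
  regroup = solve-∀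
  y≡ : y ≡ b * suc m
  y≡ = ℕ.+-cancelʳ-≡ (m * y + n * x) y (b * suc m) (begin
    y + (m * y + n * x)                 ≡⟨ cong (λ z → z + (m * z + n * x)) b+x≡y ⟨
    (b + x) + (m * (b + x) + n * x)     ≡⟨ regroup n b x ⟩
    b * suc m + 2 * m * x               ≡⟨ cong (b * suc m +_) my≡ ⟨
    b * suc m + (m * y + n * x)         ∎)

-- Enumeration of codes

lookup-injective : {xs : List A} → Unique xs → ∀ i j → lookup xs i ≡ lookup xs j → i ≡ j
lookup-injective (x∉ ∷ u) zero    zero    eq = refl
lookup-injective (x∉ ∷ u) zero    (suc j) eq = contradiction eq (All.lookup x∉ (∈-lookup j))
lookup-injective (x∉ ∷ u) (suc i) zero    eq = contradiction (sym eq) (All.lookup x∉ (∈-lookup i))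
lookup-injective (x∉ ∷ u) (suc i) (suc j) eq = cong suc (lookup-injective u i j eq)

length-filter-indicator : {Q : A → Set} (Q? : ∀ x → Dec (Q x)) (xs : List A) →
  length (filter Q? xs) ≡ listSum (List.map (indicator ∘ Q?) xs)
length-filter-indicator Q? []       = refl
length-filter-indicator Q? (x ∷ xs) with Q? x
... | yes _ = cong suc (length-filter-indicator Q? xs)
... | no _  = length-filter-indicator Q? xs

sum-tabulate : (f : Fin n → ℕ) → listSum (List.tabulate f) ≡ sum f
sum-tabulate {zero}  f = refl
sum-tabulate {suc n} f = cong (f zero +_) (sum-tabulate (f ∘ suc))

sum-map-cartesianProductWith : (f : A → B → D) (F : D → ℕ) (xs : List A) (ys : List B) →
  listSum (List.map F (cartesianProductWith f xs ys)) ≡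
  listSum (List.map (λ x → listSum (List.map (F ∘ f x) ys)) xs)
sum-map-cartesianProductWith f F []       ys = refl
sum-map-cartesianProductWith f F (x ∷ xs) ys = begin
  listSum (List.map F (List.map (f x) ys ++ cartesianProductWith f xs ys))
    ≡⟨ cong listSum (map-++ F (List.map (f x) ys) _) ⟩
  listSum (List.map F (List.map (f x) ys) ++ List.map F (cartesianProductWith f xs ys))
    ≡⟨ sum-++ (List.map F (List.map (f x) ys)) _ ⟩
  listSum (List.map F (List.map (f x) ys)) + listSum (List.map F (cartesianProductWith f xs ys))
    ≡⟨ cong₂ _+_ (cong listSum (sym (map-∘ ys))) (sum-map-cartesianProductWith f F xs ys) ⟩
  listSum (List.map (F ∘ f x) ys) + listSum (List.map (λ x → listSum (List.map (F ∘ f x) ys)) xs) ∎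
  where open ≡-Reasoning

codes : ∀ n → List (Code n)
codes zero    = [] ∷ []
codes (suc n) = cartesianProductWith (λ c i → i ∷ c) (codes n) (allFin (suc n))

∈-codes : (c : Code n) → c ∈ˡ codes n
∈-codes []      = here refl
∈-codes (i ∷ c) = ∈-cartesianProductWith⁺ (λ c i → i ∷ c) (∈-codes c) (∈-allFin i)

codes-unique : ∀ n → Unique (codes n)
codes-unique zero    = All.[] ∷ []
codes-unique (suc n) = Unique.cartesianProductWith⁺ (λ c i → i ∷ c) (λ { refl → refl , refl })
  (codes-unique n) (Unique.allFin⁺ (suc n))

sum-codes : ∀ n (F : Code n → ℕ) → listSum (List.map F (codes n)) ≡ total F
sum-codes zero    F = ℕ.+-identityʳ (F [])
sum-codes (suc n) F = begin
  listSum (List.map F (codes (suc n)))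
    ≡⟨ sum-map-cartesianProductWith (λ c i → i ∷ c) F (codes n) (allFin (suc n)) ⟩
  listSum (List.map (λ c → listSum (List.map (λ i → F (i ∷ c)) (allFin (suc n)))) (codes n))
    ≡⟨ sum-codes n _ ⟩
  total (λ c → listSum (List.map (λ i → F (i ∷ c)) (allFin (suc n))))
    ≡⟨ total-cong {n} (λ c → trans
         (cong listSum (map-tabulate {n = suc n} (λ i → i) (λ i → F (i ∷ c))))
         (sum-tabulate (λ i → F (i ∷ c)))) ⟩
  total F ∎
  where open ≡-Reasoning

-- `σ k` is an involution, so `w ↦ encode (w ∘ₚ σ k)` is a bijection from permutations up to `≈` to
-- codes. Counting thus becomes summing an indicator over all codes.
module CountByCodes
  (k : Fin n) {P : Permutation′ (suc n) → Set} {Q : Code (suc n) → Set} (Q? : ∀ c → Dec (Q c))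
  (P⇒Q : ∀ w → P w → Q (encode (w ∘ₚ σ k)))
  (Q⇒P : ∀ w → Q (encode (w ∘ₚ σ k)) → P w)
  where

  private
    σ-involutive : ∀ x → σ k ⟨$⟩ʳ (σ k ⟨$⟩ʳ x) ≡ x
    σ-involutive x = trans (cong (σ k ⟨$⟩ʳ_) (σ≡τ k x)) (trans (σ≡τ k (τ k x)) (τ-involutive k x))

    toPerm : Code (suc n) → Permutation′ (suc n)
    toPerm c = decode c ∘ₚ σ k

    toCode : Permutation′ (suc n) → Code (suc n)
    toCode w = encode (w ∘ₚ σ k)

    toPerm-toCode : ∀ w → toPerm (toCode w) ≈ w
    toPerm-toCode w x = trans (cong (σ k ⟨$⟩ʳ_) (decode-encode (w ∘ₚ σ k) x))
      (σ-involutive (w ⟨$⟩ʳ x))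

    toPerm-injective : ∀ c d → toPerm c ≈ toPerm d → c ≡ d
    toPerm-injective c d eq = decode-injective c d λ x →
      trans (sym (σ-involutive _)) (trans (cong (σ k ⟨$⟩ʳ_) (eq x)) (σ-involutive _))

    toCode-toPerm : ∀ c → toCode (toPerm c) ≡ c
    toCode-toPerm c = toPerm-injective _ c (toPerm-toCode (toPerm c))

    xs : List (Code (suc n))
    xs = filter Q? (codes (suc n))

    to : Fin (length xs) → Σ (Permutation′ (suc n)) P
    to i = toPerm (lookup xs i) , Q⇒P _ (subst Q (sym (toCode-toPerm (lookup xs i)))
      (proj₂ (∈-filter⁻ Q? {xs = codes (suc n)} (∈-lookup i))))

    member : ∀ w → P w → toCode w ∈ˡ xs
    member w p = ∈-filter⁺ Q? (∈-codes (toCode w)) (P⇒Q w p)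

    from : Σ (Permutation′ (suc n)) P → Fin (length xs)
    from (w , p) = index (member w p)

    to-from : ∀ x → proj₁ (to (from x)) ≈ proj₁ x
    to-from (w , p) x = trans
      (cong (λ c → toPerm c ⟨$⟩ʳ x) (sym (lookup-index (member w p)))) (toPerm-toCode w x)

    to-injective : ∀ {i j} → proj₁ (to i) ≈ proj₁ (to j) → i ≡ j
    to-injective {i} {j} eq = lookup-injective (Unique.filter⁺ Q? (codes-unique (suc n))) i j
      (toPerm-injective _ _ eq)

  count : Count P (total (indicator ∘ Q?))
  count = subst (Count P)
    (trans (length-filter-indicator Q? (codes (suc n))) (sum-codes (suc n) _)) record
    { to        = to
    ; from      = from
    ; to-cong   = λ { refl x → refl }
    -- The index depends a priori on the permutation and its proof; injectivity of `to` reduces the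
    -- matter to pointwise equality.
    ; from-cong = λ {x} {y} x≈y → to-injective λ i →
        trans (to-from x i) (trans (x≈y i) (sym (to-from y i)))
    ; inverse   = (λ { {x} refl i → to-from x i })
                , (λ {i} {x} x≈to → to-injective λ j → trans (to-from x j) (x≈to j))
    }

-- With the constant weight `ballot 0`, allowed codes split into ordered and disordered ones. The
-- latter number `catalan n`, so the truncated subtraction is exact.
count-ordered : ∀ (k : Fin n) →
  total (λ c → indicator (allowed? c ×-dec ordered? k c)) ≡ catalan (suc n) ∸ catalan n
count-ordered {n} k = begin
  G                                     ≡⟨ ℕ.m+n∸n≡m G (catalan n) ⟨
  G + catalan n ∸ catalan n             ≡⟨ cong (_∸ catalan n) (begin
    G + catalan n                         ≡⟨ cong (G +_) (weight≡catalan n) ⟨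
    G + allowedWeight n (ballot 0)        ≡⟨ cong (G +_) (disorderedWeight≡ k (ballot 0)) ⟨
    G + disorderedWeight k (ballot 0)     ≡⟨ total-+ {suc n} good bad ⟨
    total (λ c → good c + bad c)          ≡⟨ total-cong {suc n} (λ c →
                                               split (allowed? c) (ordered? k c)) ⟩
    allowedWeight (suc n) (ballot 0)      ≡⟨ weight≡catalan (suc n) ⟩
    catalan (suc n)                       ∎) ⟩
  catalan (suc n) ∸ catalan n           ∎
  where
  open ≡-Reasoning
  good bad : Code (suc n) → ℕ
  good c = indicator (allowed? c ×-dec ordered? k c)
  bad c  = indicator (allowed? c) * (indicator (¬? (ordered? k c)) * 1)
  G : ℕ
  G = total good
  weight≡catalan : ∀ n → allowedWeight n (ballot 0) ≡ catalan n
  weight≡catalan n = trans (allowedWeight-ballot n 0)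
    (trans (cong (λ m → ballot m 0) (ℕ.+-identityʳ n)) (sym (catalan≡ballot n)))
  split : (P? : Dec P) (Q? : Dec Q) →
          indicator (P? ×-dec Q?) + indicator P? * (indicator (¬? Q?) * 1) ≡ indicator P? * 1
  split (yes _) (yes _) = refl
  split (yes _) (no _)  = refl
  split (no _)  _       = refl

-- Codes of distributive and modular intervals

GoodCode : Fin n → Code (suc n) → Set
GoodCode k c = Allowed c × Ordered k c

goodCode? : (k : Fin n) (c : Code (suc n)) → Dec (GoodCode k c)
goodCode? k c = allowed? c ×-dec ordered? k c

no321⇒goodCode : (k : Fin n) (w : Permutation′ (suc n)) → σ k ≤wk w → NoOther321 k w →
                 GoodCode k (encode (w ∘ₚ σ k))
no321⇒goodCode {n} k w σk≤w no321 =
    avoids⇒allowed (encode u) (λ {a} {b} {c} ab bc → proj₁ avoids (back a b ab) (back b c bc))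
  , ⇒ordered k (encode u) (proj₂ avoids ∘ back (inject₁ k) (suc k))
  where
  u : Permutation′ (suc n)
  u = w ∘ₚ σ k
  avoids : Avoids321 u × ¬ Inv u (inject₁ k) (suc k)
  avoids = Translate.avoids k w (≤wk⇒⊑ σk≤w (inject₁ k) (suc k) (Inv-σ k)) no321
  back : decode (encode u) ⊑ u
  back = ≈⇒⊑ (decode (encode u)) u (decode-encode u)

goodCode⇒distributive : (k : Fin n) (w : Permutation′ (suc n)) → GoodCode k (encode (w ∘ₚ σ k)) →
                        σ k ≤wk w × DistributiveInterval (σ k) w
goodCode⇒distributive {n} k w (allowed , ordered) =
  ⊑⇒≤wk (σ⊑ (Translate.pair-inverted k w
    (ordered⇒ k (encode u) ordered ∘ forth (inject₁ k) (suc k)))) ,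
  Distributive.distributive k w (Translate.noOther321 k w λ {a} {b} {c} ab bc →
    allowed⇒avoids (encode u) allowed (forth a b ab) (forth b c bc))
  where
  u : Permutation′ (suc n)
  u = w ∘ₚ σ k
  forth : u ⊑ decode (encode u)
  forth = ≈⇒⊑ u (decode (encode u)) λ x → sym (decode-encode u x)

theorem5p11 : ∀ (n : ℕ) (k : Fin n) →
    (∀ (w : Permutation′ (suc n)) → σ k ≤wk w →
       DistributiveInterval (σ k) w ⇔ ModularInterval (σ k) w)
    × Count (λ w → σ k ≤wk w × DistributiveInterval (σ k) w) (catalan (suc n) ∸ catalan n)
    × Count (λ w → σ k ≤wk w × ModularInterval (σ k) w) (catalan (suc n) ∸ catalan n)
theorem5p11 n k =
    -- The implications run in a circle: distributive, modular, no other 321-pattern, distributive.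
    (λ w σk≤w → mk⇔ distributive⇒modular
      (λ M → Distributive.distributive k w (modular⇒no321 k w σk≤w M)))
  , subst (Count _) (count-ordered k) (CountByCodes.count k (goodCode? k)
      (λ w (σk≤w , D) → modular⇒goodCode w (σk≤w , distributive⇒modular D))
      (goodCode⇒distributive k))
  , subst (Count _) (count-ordered k) (CountByCodes.count k (goodCode? k)
      modular⇒goodCode
      (λ w good → map₂ distributive⇒modular (goodCode⇒distributive k w good)))
  where
  modular⇒goodCode : ∀ w → σ k ≤wk w × ModularInterval (σ k) w → GoodCode k (encode (w ∘ₚ σ k))
  modular⇒goodCode w (σk≤w , M) = no321⇒goodCode k w σk≤w (modular⇒no321 k w σk≤w M)
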